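{- Let $M$ be a regular matroid with a triangulating circuit-cocircuit signature $(\sigma,\sigma^*)$. Let $\vec f$ be an arc with support $\{f\}$ and let $\vec O_1,\vec O_2$ be $(\sigma,\sigma^*)$-compatible orientations with $[\vec f]\cdot\vec O_1=\vec O_2$ (i.e. $([\vec f]\cdot[\vec O_1])^\circ=\vec O_2$). Then $\vec O_1$ can be transformed into $\vec O_2$ by the following process: (1) reverse at most one signed circuit or signed cocircuit containing $f$ that is compatible with $\vec O_1$; (2) reverse $f$; (3) reverse at most one signed circuit or signed cocircuit containing $f$ that is compatible with the current orientation. (Reversing $\vec C$ compatible with $\vec O$ means replacing $\vec O$ by $\mathrm{rev}_C(\vec O)$.) Furthermore: (a) a reversal occurs in step (1) if and only if $\vec f\sim\vec O_1$; (b) a reversal occurs in step (3) if and only if $-\vec f\sim\vec O_2$; (c) if reversals occur in both steps (1) and (3), then one is a circuit reversal and the other a cocircuit reversal; (d) if reversals occur in both steps (1) and (3), with reversed signed circuit $\vec C$ and reversed signed cocircuit $\vec C^*$, then $C\cap C^*$ has exactly two elements, one of which is $f$, and with $g$ the element of $(C\cap C^*)\setminus\{f\}$ we have $\vec O_2=\mathrm{rev}_{(C\cup C^*)\setminus\{g\}}(\vec O_1)$.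
   Context: $M=M(A)$ is the regular matroid on finite $E$ represented by a real totally unimodular matrix $A$ of full row rank (bases: index sets of nonsingular maximal square submatrices; circuits: minimal sets in no basis; cocircuits: minimal sets meeting every basis). 1-chains are elements of $\mathbb Z^E$, $\vec P(x)$ the coefficient at $x$, $P$ the support; simple means coefficients in $\{ -1,0,1\}$; an arc is a simple 1-chain with one-element support. A signed circuit (cocircuit) is a simple element of $\ker A$ (row space of $A$) whose support is a circuit (cocircuit). An orientation is a map $E\to\{+,-\}$; $\vec P\sim\vec O$ means the sign of $\vec P(x)$ equals $\vec O(x)$ for all $x\in P$; $\mathrm{rev}_P(\vec O)$ flips $\vec O$ on $P\subseteq E$. Circuit-cocircuit equivalence is generated by $\vec O\mapsto\mathrm{rev}_C(\vec O)$ for signed circuits/cocircuits $\vec C\sim\vec O$; $[\vec O]$ is the class. $S(M)=\mathbb Z^E/(\Lambda+\Lambda^*)$ with $\Lambda,\Lambda^*$ generated by signed circuits, signed cocircuits. Canonical action: for an arc $\vec f$ and class $G$, pick $\vec O\in G$ with $-\vec f\sim\vec O$ and set $[\vec f]\cdot G=[\mathrm{rev}_{\{f\}}(\vec O)]$ (well defined, extends to a simply transitive action of $S(M)$). A circuit signature $\sigma$ picks one signed circuit on each circuit; a cocircuit signature $\sigma^*$ likewise. Fourientations are maps $E\to$ subsets of $\{+,-\}$; $\vec F(B,\sigma)$ is $\{+,-\}$ on the basis $B$ and, at $x\notin B$, the sign of $\sigma(C_x)(x)$ with $C_x\subseteq B\cup\{x\}$ the fundamental circuit; $\vec F(B,\sigma^*)$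 is $\{+,-\}$ off $B$ and, at $x\in B$, the sign of $\sigma^*(C^*_x)(x)$ with $C^*_x\subseteq(E\setminus B)\cup\{x\}$ the fundamental cocircuit. A 1-chain $\vec P$ is compatible with a fourientation $\vec F$ if the sign of $\vec P(x)$ lies in $\vec F(x)$ for all $x\in P$; $-\vec F$ swaps $+,-$. $(\sigma,\sigma^*)$ is triangulating if for all distinct bases $B_1,B_2$ no signed circuit is compatible with $\vec F(B_1,\sigma)\cap-\vec F(B_2,\sigma)$ and no signed cocircuit is compatible with $\vec F(B_1,\sigma^*)\cap-\vec F(B_2,\sigma^*)$. An orientation is $(\sigma,\sigma^*)$-compatible if all signed circuits compatible with it are in $\sigma$ and all signed cocircuits compatible with it are in $\sigma^*$; for triangulating signatures each class contains a unique one, denoted $[\vec O]^\circ$, and $s\cdot\vec O:=(s\cdot[\vec O])^\circ$ for compatible $\vec O$. -}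

module Defs where

open import Data.Nat as ℕ using (ℕ; zero; suc)
open import Data.Integer as ℤ using (ℤ; +_; sign; -[1+_])
open import Data.Rational as ℚ using (ℚ)
open import Data.Fin using (Fin; zero; suc; punchIn)
open import Data.Fin.Subset using (Subset; _∈_; _∉_; _⊆_; _⊂_; _∩_; _∪_; _─_; ⁅_⁆; ⊤)
open import Data.Vec using (Vec; lookup; tabulate)
open import Data.Bool using (Bool; true; false; if_then_else_; not)
open import Data.Sign as Sign using (Sign)
open import Data.Product using (Σ; ∃; _×_; _,_)
open import Data.Sum using (_⊎_)
open import Data.Maybe using (Maybe; just; nothing)
open import Function using (Injective)
open import Relation.Nullary using (¬_; does)
open import Relation.Binary.PropositionalEquality using (_≡_; _≢_; _≗_)
open import Relation.Binary.Construct.Closure.Equivalence using (EqClosure)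

-- r × n integer matrices (a TU real matrix has entries in {-1,0,1})
Mat : ℕ → ℕ → Set
Mat r n = Fin r → Fin n → ℤ

sumℤ : (k : ℕ) → (Fin k → ℤ) → ℤ
sumℤ zero    g = + 0
sumℤ (suc k) g = g zero ℤ.+ sumℤ k (λ i → g (suc i))

sumℚ : (k : ℕ) → (Fin k → ℚ) → ℚ
sumℚ zero    g = ℚ.0ℚ
sumℚ (suc k) g = g zero ℚ.+ sumℚ k (λ i → g (suc i))

altSign : ∀ {k} → Fin k → ℤ
altSign zero    = + 1
altSign (suc zero) = -[1+ 0 ]
altSign (suc (suc j)) = altSign j

det : (k : ℕ) → (Fin k → Fin k → ℤ) → ℤ
det zero    M = + 1
det (suc k) M =
  sumℤ (suc k) (λ j → altSign j ℤ.* (M zero j ℤ.* det k (λ i j' → M (suc i) (punchIn j j'))))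

subMat : ∀ {r n k} → Mat r n → (Fin k → Fin r) → (Fin k → Fin n) → Fin k → Fin k → ℤ
subMat A ρ κ i j = A (ρ i) (κ j)

-- totally unimodular: every square submatrix has determinant in {-1,0,1}
-- (submatrices given by arbitrary row/column index maps; repeated indices give det 0)
TotallyUnimodular : ∀ {r n} → Mat r n → Set
TotallyUnimodular {r} {n} A =
  ∀ k (ρ : Fin k → Fin r) (κ : Fin k → Fin n) →
    det k (subMat A ρ κ) ≡ + 1 ⊎ det k (subMat A ρ κ) ≡ + 0 ⊎ det k (subMat A ρ κ) ≡ -[1+ 0 ]

FullRowRank : ∀ {r n} → Mat r n → Set
FullRowRank {r} {n} A = Σ (Fin r → Fin n) λ κ → det r (subMat A (λ i → i) κ) ≢ + 0

IsBasis : ∀ {r n} → Mat r n → Subset n → Set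
IsBasis {r} {n} A B =
  Σ (Fin r → Fin n) λ κ →
    Injective _≡_ _≡_ κ × (∀ j → κ j ∈ B) × (∀ x → x ∈ B → ∃ λ j → κ j ≡ x)
    × det r (subMat A (λ i → i) κ) ≢ + 0

Independent : ∀ {r n} → Mat r n → Subset n → Set
Independent A D = ∃ λ B → IsBasis A B × D ⊆ B

IsCircuit : ∀ {r n} → Mat r n → Subset n → Set
IsCircuit A C = ¬ Independent A C × (∀ D → D ⊂ C → Independent A D)

Meets : ∀ {n} → Subset n → Subset n → Set
Meets D B = ∃ λ x → x ∈ D × x ∈ B

IsCocircuit : ∀ {r n} → Mat r n → Subset n → Set
IsCocircuit A D =
  (∀ B → IsBasis A B → Meets D B) × (∀ D' → D' ⊂ D → ∃ λ B → IsBasis A B × ¬ Meets D' B)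

Chain : ℕ → Set
Chain n = Fin n → ℤ

supp : ∀ {n} → Chain n → Subset n
supp P = tabulate (λ x → not (does (P x ℤ.≟ + 0)))

negChain : ∀ {n} → Chain n → Chain n
negChain P x = ℤ.- (P x)

Simple : ∀ {n} → Chain n → Set
Simple P = ∀ x → P x ≡ + 1 ⊎ P x ≡ + 0 ⊎ P x ≡ -[1+ 0 ]

InKernel : ∀ {r n} → Mat r n → Chain n → Set
InKernel {r} {n} A P = ∀ i → sumℤ n (λ x → A i x ℤ.* P x) ≡ + 0

toℚ : ℤ → ℚ
toℚ z = z ℚ./ 1

-- in the row space of A (coefficients rational; for a rational matrix and
-- rational vector this is the same as real solvability)
InRowSpace : ∀ {r n} → Mat r n → Chain n → Set
InRowSpace {r} {n} A P =
  Σ (Fin r → ℚ) λ y → ∀ x → sumℚ r (λ i → y i ℚ.* toℚ (A i x)) ≡ toℚ (P x)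

SignedCircuit : ∀ {r n} → Mat r n → Chain n → Set
SignedCircuit A P = Simple P × InKernel A P × IsCircuit A (supp P)

SignedCocircuit : ∀ {r n} → Mat r n → Chain n → Set
SignedCocircuit A P = Simple P × InRowSpace A P × IsCocircuit A (supp P)

IsArc : ∀ {n} → Chain n → Fin n → Set
IsArc a f = Simple a × (∀ x → a x ≢ + 0 → x ≡ f) × a f ≢ + 0

Orientation : ℕ → Set
Orientation n = Fin n → Sign

_∼_ : ∀ {n} → Chain n → Orientation n → Set
P ∼ O = ∀ x → P x ≢ + 0 → sign (P x) ≡ O x

rev : ∀ {n} → Subset n → Orientation n → Orientation n
rev S O x = if lookup S x then Sign.opposite (O x) else O x

RevStep : ∀ {r n} → Mat r n → Orientation n → Orientation n → Set
RevStep A O O' =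
  ∃ λ P → (SignedCircuit A P ⊎ SignedCocircuit A P) × P ∼ O × O' ≗ rev (supp P) O

CCEquiv : ∀ {r n} → Mat r n → Orientation n → Orientation n → Set
CCEquiv A O O' = ∃ λ O'' → EqClosure (RevStep A) O O'' × O'' ≗ O'

-- a circuit signature: for every circuit C, σ C is a signed circuit with support C
-- (values of σ on non-circuits are irrelevant)
IsCircuitSignature : ∀ {r n} → Mat r n → (Subset n → Chain n) → Set
IsCircuitSignature A σ = ∀ C → IsCircuit A C → SignedCircuit A (σ C) × supp (σ C) ≡ C

IsCocircuitSignature : ∀ {r n} → Mat r n → (Subset n → Chain n) → Set
IsCocircuitSignature A σ* = ∀ C → IsCocircuit A C → SignedCocircuit A (σ* C) × supp (σ* C) ≡ C

InSig : ∀ {n} → (Subset n → Chain n) → Chain n → Set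
InSig σ P = σ (supp P) ≗ P

Fourientation : ℕ → Set₁
Fourientation n = Fin n → Sign → Set

_∩F_ : ∀ {n} → Fourientation n → Fourientation n → Fourientation n
(F ∩F G) x s = F x s × G x s

-F_ : ∀ {n} → Fourientation n → Fourientation n
(-F F) x s = F x (Sign.opposite s)

-- F(B,σ): bioriented on B; at x ∉ B the sign of σ(C_x)(x), C_x ⊆ B ∪ {x} the fundamental circuit
FB : ∀ {r n} → Mat r n → Subset n → (Subset n → Chain n) → Fourientation n
FB A B σ x s =
  x ∈ B ⊎ (x ∉ B × ∃ λ C → IsCircuit A C × C ⊆ (B ∪ ⁅ x ⁆) × sign (σ C x) ≡ s)

-- F(B,σ*): bioriented off B; at x ∈ B the sign of σ*(C*_x)(x), C*_x ⊆ (E∖B) ∪ {x}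
FB* : ∀ {r n} → Mat r n → Subset n → (Subset n → Chain n) → Fourientation n
FB* A B σ* x s =
  x ∉ B ⊎ (x ∈ B × ∃ λ D → IsCocircuit A D × D ⊆ ((⊤ ─ B) ∪ ⁅ x ⁆) × sign (σ* D x) ≡ s)

CompatibleF : ∀ {n} → Chain n → Fourientation n → Set
CompatibleF P F = ∀ x → P x ≢ + 0 → F x (sign (P x))

Triangulating : ∀ {r n} → Mat r n → (Subset n → Chain n) → (Subset n → Chain n) → Set
Triangulating A σ σ* =
  ∀ B₁ B₂ → IsBasis A B₁ → IsBasis A B₂ → B₁ ≢ B₂ →
    (∀ P → SignedCircuit A P → ¬ CompatibleF P (FB A B₁ σ ∩F (-F FB A B₂ σ)))
    × (∀ P → SignedCocircuit A P → ¬ CompatibleF P (FB* A B₁ σ* ∩F (-F FB* A B₂ σ*)))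

SigCompatible : ∀ {r n} → Mat r n → (Subset n → Chain n) → (Subset n → Chain n) → Orientation n → Set
SigCompatible A σ σ* O =
  (∀ P → SignedCircuit A P → P ∼ O → InSig σ P)
  × (∀ P → SignedCocircuit A P → P ∼ O → InSig σ* P)

-- [a] · [O₁] contains O₂ : pick O ∈ [O₁] with -a ∼ O, then [a]·[O₁] = [rev_{supp a} O]
ArcActsTo : ∀ {r n} → Mat r n → Chain n → Orientation n → Orientation n → Set
ArcActsTo A a O₁ O₂ =
  ∃ λ O → CCEquiv A O₁ O × negChain a ∼ O × CCEquiv A (rev (supp a) O) O₂

-- [a] · O₁ = O₂ for compatible O₁,O₂, i.e. ([a]·[O₁])° = O₂ :
-- O₂ is the (unique) compatible orientation of the class [a]·[O₁]
ArcActionCompat : ∀ {r n} → Mat r n → (Subset n → Chain n) → (Subset n → Chain n) →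
                  Chain n → Orientation n → Orientation n → Set
ArcActionCompat A σ σ* a O₁ O₂ = SigCompatible A σ σ* O₂ × ArcActsTo A a O₁ O₂

data Kind : Set where
  circuit cocircuit : Kind

SignedOf : ∀ {r n} → Mat r n → Kind → Chain n → Set
SignedOf A circuit   P = SignedCircuit A P
SignedOf A cocircuit P = SignedCocircuit A P

ValidStep : ∀ {r n} → Mat r n → Fin n → Maybe (Kind × Chain n) → Orientation n → Set
ValidStep A f nothing        O = Data.Unit.⊤
  where import Data.Unit
ValidStep A f (just (k , P)) O = SignedOf A k P × f ∈ supp P × P ∼ O

applyStep : ∀ {n} → Maybe (Kind × Chain n) → Orientation n → Orientation n
applyStep nothing        O = O
applyStep (just (k , P)) O = rev (supp P) O

IsJust : ∀ {A : Set} → Maybe A → Set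
IsJust nothing  = Data.Empty.⊥
  where import Data.Empty
IsJust (just _) = Data.Unit.⊤
  where import Data.Unit

record Process {r n} (A : Mat r n) (a : Chain n) (f : Fin n) (O₁ O₂ : Orientation n) : Set where
  field
    step₁  : Maybe (Kind × Chain n)
    valid₁ : ValidStep A f step₁ O₁
    step₃  : Maybe (Kind × Chain n)
    valid₃ : ValidStep A f step₃ (rev ⁅ f ⁆ (applyStep step₁ O₁))
    result : applyStep step₃ (rev ⁅ f ⁆ (applyStep step₁ O₁)) ≗ O₂
    partA  : (IsJust step₁ → a ∼ O₁) × (a ∼ O₁ → IsJust step₁)
    partB  : (IsJust step₃ → negChain a ∼ O₂) × (negChain a ∼ O₂ → IsJust step₃)
    partC  : ∀ k₁ P₁ k₃ P₃ → step₁ ≡ just (k₁ , P₁) → step₃ ≡ just (k₃ , P₃) → k₁ ≢ k₃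
    -- (d) (symmetric in the circuit C and cocircuit C*)
    partD  : ∀ k₁ P₁ k₃ P₃ → step₁ ≡ just (k₁ , P₁) → step₃ ≡ just (k₃ , P₃) →
             ∃ λ g → g ≢ f
               × (∀ x → x ∈ (supp P₁ ∩ supp P₃) → x ≡ f ⊎ x ≡ g)
               × f ∈ (supp P₁ ∩ supp P₃) × g ∈ (supp P₁ ∩ supp P₃)
               × O₂ ≗ rev ((supp P₁ ∪ supp P₃) ─ ⁅ g ⁆) O₁

{-# OPTIONS --safe #-}

-- Equivalent orientations differ by a vector of ker A and a vector of the row space, both
-- conforming to the first orientation and, by orthogonality, disjoint.  Over a totally unimodular
-- matrix such vectors split into conforming signed circuits (cocircuits).  A signed circuit C
-- that conforms to O₁ while − C conforms to O₂ contradicts compatibility of O₁ and O₂, since the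
-- signature contains only one of ± C.  Hence every piece of the difference between O₁ and O₂ must
-- pass through f, which leaves room for at most one piece on each side of the reversal of f.
module Submission where

open import Defs
open import Data.Nat using (ℕ)
open import Data.Fin using (Fin)
open import Data.Fin.Subset using (Subset)
open import Data.Nat as ℕ using (zero; suc)
import Data.Nat.Properties as ℕₚ
import Data.Nat.Induction as ℕᵢ
open import Induction.WellFounded using (Acc; acc)
open import Data.Integer as ℤ using (ℤ; _+_; _*_; -_; -[1+_]; 0ℤ; 1ℤ; sign; ∣_∣; _◃_; _⊖_)
import Data.Integer.Properties as ℤₚ
open import Data.Integer.Tactic.RingSolver using (solve-∀)
open import Data.Rational as ℚ using (ℚ)
import Data.Rational.Properties as ℚₚ
open import Data.Rational.Unnormalised as ℚᵘ using (mkℚᵘ; *≡*)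
import Data.Rational.Unnormalised.Properties as ℚᵘₚ
open import Data.Bool using (true; false; if_then_else_; not)
open import Data.Empty using (⊥)
open import Data.Unit using (tt)
open import Data.Maybe using (just; nothing)
open import Data.Vec using (lookup; tabulate; _∷_; there)
open import Data.Vec.Properties using (lookup∘tabulate; lookup⇒[]=; []=⇒lookup; tabulate-cong)
open import Data.Fin using (zero; suc; punchIn; punchOut; _≟_)
open import Data.Fin.Properties using (punchIn-punchOut; punchInᵢ≢i; any?)
open import Data.Fin.Subset using (_∈_; _∉_; _⊂_; ⁅_⁆; _∩_; _∪_; _─_)
import Data.Fin.Subset as Subset
open import Data.Fin.Subset.Properties using (p⊂q⇒∣p∣<∣q∣; x∈⁅x⁆; x∈⁅y⁆⇒x≡y; x∈p∩q⁺; x∈p∩q⁻; x∈p∪q⁺; x∈p∪q⁻; p─q⊆p; x∈p∧x∉q⇒x∈p─q)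
open import Data.Sign as Sign using (Sign; opposite)
import Data.Sign.Properties as Signₚ
open import Data.Product using (∃; _×_; _,_; proj₁; proj₂; map)
open import Data.Sum using (_⊎_; inj₁; inj₂)
open import Function using (_∘_; Injective)
open import Relation.Nullary using (¬_; Dec; yes; no; contradiction; does; ¬?; _×-dec_; decidable-stable)
open import Relation.Nullary.Decidable using (dec-true; dec-false)
open import Relation.Unary using (Decidable)
open import Relation.Binary.Structures using (IsEquivalence)
open import Relation.Binary.Construct.Closure.Equivalence using (fold)
open import Relation.Binary.PropositionalEquality
open import Algebra.Bundles using (module CommutativeRing)
import Algebra.Properties.Semiring.Sum
import Algebra.Properties.CommutativeMonoid.Sum ℕₚ.+-0-commutativeMonoid as ℕ-Sum

open ≡-Reasoning

-- The delicate case is `a ∼ O₁`. Some signed circuit or cocircuit P through f must be reversed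
-- first, and an arbitrary choice of P can be wrong: the remaining difference to O₂ may have parts
-- of both kinds. Its pieces of the kind of P conform to the orientation after P and f have been
-- reversed, not to O₁, so compatibility of O₁ says nothing about them. The remedy is to correct P
-- instead of choosing it well. P plus the remainder of its own kind does conform to O₁, because a
-- second reversal of an element off f cancels the first; compatibility then forces the sum to be a
-- single signed circuit or cocircuit with coefficient 1 or -1 at f. It replaces P, and what remains
-- is of the other kind. Total unimodularity enters through Cramer's rule: the entries of a basis
-- tableau are products of signs and minors, so fundamental circuits and cocircuits come out simple.
-- Since `det` is the Laplace expansion along the first row, the properties of determinants behind
-- Cramer's rule are derived from that formula.

module ℤ-Sum = Algebra.Properties.Semiring.Sum ℤₚ.+-*-semiring
module ℚ-Sum = Algebra.Properties.Semiring.Sum (CommutativeRing.semiring ℚₚ.+-*-commutativeRing)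

-- Finite sums

sumℤ≡sum : ∀ k (g : Fin k → ℤ) → sumℤ k g ≡ ℤ-Sum.sum g
sumℤ≡sum zero    g = refl
sumℤ≡sum (suc k) g = cong (g zero +_) (sumℤ≡sum k (g ∘ suc))

sumℤ-cong : ∀ k {g h : Fin k → ℤ} → g ≗ h → sumℤ k g ≡ sumℤ k h
sumℤ-cong k {g} {h} e = begin
  sumℤ k g    ≡⟨ sumℤ≡sum k g ⟩
  ℤ-Sum.sum g ≡⟨ ℤ-Sum.sum-cong-≗ e ⟩
  ℤ-Sum.sum h ≡⟨ sumℤ≡sum k h ⟨
  sumℤ k h    ∎

sumℤ-+ : ∀ k (g h : Fin k → ℤ) → sumℤ k (λ i → g i + h i) ≡ sumℤ k g + sumℤ k h
sumℤ-+ k g h = begin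
  sumℤ k (λ i → g i + h i)    ≡⟨ sumℤ≡sum k _ ⟩
  ℤ-Sum.sum (λ i → g i + h i) ≡⟨ ℤ-Sum.∑-distrib-+ g h ⟩
  ℤ-Sum.sum g + ℤ-Sum.sum h   ≡⟨ cong₂ _+_ (sumℤ≡sum k g) (sumℤ≡sum k h) ⟨
  sumℤ k g + sumℤ k h         ∎

sumℤ-* : ∀ k c (g : Fin k → ℤ) → sumℤ k (λ i → c * g i) ≡ c * sumℤ k g
sumℤ-* k c g = begin
  sumℤ k (λ i → c * g i)    ≡⟨ sumℤ≡sum k _ ⟩
  ℤ-Sum.sum (λ i → c * g i) ≡⟨ ℤ-Sum.*-distribˡ-sum c g ⟨
  c * ℤ-Sum.sum g           ≡⟨ cong (c *_) (sumℤ≡sum k g) ⟨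
  c * sumℤ k g              ∎

sumℤ-neg : ∀ k (g : Fin k → ℤ) → sumℤ k (λ i → - g i) ≡ - sumℤ k g
sumℤ-neg k g = begin
  sumℤ k (λ i → - g i)          ≡⟨ sumℤ-cong k (λ i → sym (ℤₚ.-1*i≡-i (g i))) ⟩
  sumℤ k (λ i → -[1+ 0 ] * g i) ≡⟨ sumℤ-* k -[1+ 0 ] g ⟩
  -[1+ 0 ] * sumℤ k g           ≡⟨ ℤₚ.-1*i≡-i _ ⟩
  - sumℤ k g                    ∎

sumℤ-swap : ∀ k l (g : Fin k → Fin l → ℤ) →
            sumℤ k (λ i → sumℤ l (g i)) ≡ sumℤ l (λ j → sumℤ k (λ i → g i j))
sumℤ-swap k l g = begin
  sumℤ k (λ i → sumℤ l (g i))               ≡⟨ sumℤ-cong k (λ i → sumℤ≡sum l (g i)) ⟩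
  sumℤ k (λ i → ℤ-Sum.sum (g i))            ≡⟨ sumℤ≡sum k _ ⟩
  ℤ-Sum.sum (λ i → ℤ-Sum.sum (g i))         ≡⟨ ℤ-Sum.∑-comm g ⟩
  ℤ-Sum.sum (λ j → ℤ-Sum.sum (λ i → g i j)) ≡⟨ sumℤ≡sum l _ ⟨
  sumℤ l (λ j → ℤ-Sum.sum (λ i → g i j))    ≡⟨ sumℤ-cong l (λ j → sumℤ≡sum k (λ i → g i j)) ⟨
  sumℤ l (λ j → sumℤ k (λ i → g i j))       ∎

sumℤ-zero : ∀ k {g : Fin k → ℤ} → (∀ i → g i ≡ 0ℤ) → sumℤ k g ≡ 0ℤ
sumℤ-zero zero    e = refl
sumℤ-zero (suc k) e = cong₂ _+_ (e zero) (sumℤ-zero k (e ∘ suc))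

sumℤ-single : ∀ k {g : Fin k → ℤ} p → (∀ i → i ≢ p → g i ≡ 0ℤ) → sumℤ k g ≡ g p
sumℤ-single (suc k) {g} zero e =
  trans (cong (g zero +_) (sumℤ-zero k (λ i → e (suc i) λ ()))) (ℤₚ.+-identityʳ _)
sumℤ-single (suc k) {g} (suc p) e =
  trans (cong₂ _+_ (e zero λ ()) (sumℤ-single k p (λ i i≢p → e (suc i) λ { refl → i≢p refl })))
        (ℤₚ.+-identityˡ _)

-- Determinants

det-cong : ∀ k {M N : Fin k → Fin k → ℤ} → (∀ i j → M i j ≡ N i j) → det k M ≡ det k N
det-cong zero    e = refl
det-cong (suc k) e = sumℤ-cong (suc k) λ j →
  cong (altSign j *_) (cong₂ _*_ (e zero j) (det-cong k (λ i j' → e (suc i) (punchIn j j'))))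

altSign-suc : ∀ {k} (j : Fin k) → altSign (suc j) ≡ - altSign j
altSign-suc zero          = refl
altSign-suc (suc zero)    = refl
altSign-suc (suc (suc j)) = altSign-suc j

altSign-square : ∀ {k} (j : Fin k) → altSign j * altSign j ≡ 1ℤ
altSign-square zero          = refl
altSign-square (suc zero)    = refl
altSign-square (suc (suc j)) = altSign-square j

-- (j , l) encodes the ordered pair of distinct columns j, punchIn j l; this reverses the pair.
flipPair : ∀ {k} → Fin (suc k) → Fin k → Fin (suc k) × Fin k
flipPair {suc k} zero    l       = suc l , zero
flipPair (suc j) zero    = zero , j
flipPair (suc j) (suc l) = map suc suc (flipPair j l)

module _ {k} (j : Fin (suc k)) (l : Fin k) where
  flip₁ = proj₁ (flipPair j l)
  flip₂ = proj₂ (flipPair j l)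

flip₁≡ : ∀ {k} (j : Fin (suc k)) l → flip₁ j l ≡ punchIn j l
flip₁≡ {suc k} zero    l       = refl
flip₁≡ (suc j) zero    = refl
flip₁≡ (suc j) (suc l) = cong suc (flip₁≡ j l)

punchIn-flip : ∀ {k} (j : Fin (suc k)) l → punchIn (flip₁ j l) (flip₂ j l) ≡ j
punchIn-flip {suc k} zero    l       = refl
punchIn-flip (suc j) zero    = refl
punchIn-flip (suc j) (suc l) = cong suc (punchIn-flip j l)

punchIn-punchIn-flip : ∀ {k} (j : Fin (suc (suc k))) l x →
  punchIn (flip₁ j l) (punchIn (flip₂ j l) x) ≡ punchIn j (punchIn l x)
punchIn-punchIn-flip zero    l       x       = refl
punchIn-punchIn-flip (suc j) zero    x       = refl
punchIn-punchIn-flip (suc j) (suc l) zero    = refl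
punchIn-punchIn-flip (suc j) (suc l) (suc x) = cong suc (punchIn-punchIn-flip j l x)

altSign-flip : ∀ {k} (j : Fin (suc k)) l →
  altSign (flip₁ j l) * altSign (flip₂ j l) ≡ - (altSign j * altSign l)
altSign-flip {suc k} zero l = begin
  altSign (suc l) * 1ℤ      ≡⟨ ℤₚ.*-identityʳ _ ⟩
  altSign (suc l)             ≡⟨ altSign-suc l ⟩
  - altSign l               ≡⟨ cong -_ (ℤₚ.*-identityˡ _) ⟨
  - (1ℤ * altSign l)      ∎
altSign-flip (suc j) zero = begin
  1ℤ * altSign j                 ≡⟨ ℤₚ.*-identityˡ _ ⟩
  altSign j                        ≡⟨ ℤₚ.neg-involutive _ ⟨
  - (- altSign j)              ≡⟨ cong -_ (altSign-suc j) ⟨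
  - altSign (suc j)              ≡⟨ cong -_ (ℤₚ.*-identityʳ _) ⟨
  - (altSign (suc j) * 1ℤ)     ∎
altSign-flip (suc j) (suc l) = begin
  altSign (suc (flip₁ j l)) * altSign (suc (flip₂ j l))
    ≡⟨ cong₂ _*_ (altSign-suc (flip₁ j l)) (altSign-suc (flip₂ j l)) ⟩
  - altSign (flip₁ j l) * - altSign (flip₂ j l)
    ≡⟨ neg*neg (altSign (flip₁ j l)) (altSign (flip₂ j l)) ⟩
  altSign (flip₁ j l) * altSign (flip₂ j l)  ≡⟨ altSign-flip j l ⟩
  - (altSign j * altSign l)
    ≡⟨ cong -_ (neg*neg (altSign j) (altSign l)) ⟨
  - (- altSign j * - altSign l)
    ≡⟨ cong -_ (cong₂ _*_ (altSign-suc j) (altSign-suc l)) ⟨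
  - (altSign (suc j) * altSign (suc l))    ∎
  where
  neg*neg : ∀ a b → - a * - b ≡ a * b
  neg*neg = solve-∀

-- Reversing pairs permutes the summands: the pairs with first column zero trade places with those
-- with second column zero, and induction handles the others.
sumℤ-flip : ∀ k (G : Fin (suc k) → Fin k → ℤ) →
  sumℤ (suc k) (λ j → sumℤ k (G j)) ≡ sumℤ (suc k) (λ j → sumℤ k (λ l → G (flip₁ j l) (flip₂ j l)))
sumℤ-flip zero    G = refl
sumℤ-flip (suc k) G = begin
  s₀ + sumℤ (suc k) (λ j → G (suc j) zero + sumℤ k (λ l → G (suc j) (suc l)))
    ≡⟨ cong (s₀ +_) (sumℤ-+ (suc k) (λ j → G (suc j) zero) (λ j → sumℤ k (λ l → G (suc j) (suc l)))) ⟩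
  s₀ + (s₁ + sumℤ (suc k) (λ j → sumℤ k (λ l → G (suc j) (suc l))))
    ≡⟨ cong (λ t → s₀ + (s₁ + t)) (sumℤ-flip k (λ j l → G (suc j) (suc l))) ⟩
  s₀ + (s₁ + s₂)
    ≡⟨ rearrange s₀ s₁ s₂ ⟩
  s₁ + (s₀ + s₂)
    ≡⟨ cong (s₁ +_) (sumℤ-+ (suc k) (G zero) (λ j → sumℤ k (λ l → G (suc (flip₁ j l)) (suc (flip₂ j l))))) ⟨
  s₁ + sumℤ (suc k) (λ j → G zero j + sumℤ k (λ l → G (suc (flip₁ j l)) (suc (flip₂ j l)))) ∎
  where
  s₀ = sumℤ (suc k) (G zero)
  s₁ = sumℤ (suc k) (λ j → G (suc j) zero)
  s₂ = sumℤ (suc k) (λ j → sumℤ k (λ l → G (suc (flip₁ j l)) (suc (flip₂ j l))))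
  rearrange : ∀ a b c → a + (b + c) ≡ b + (a + c)
  rearrange = solve-∀

det-expand₂ : ∀ k (M : Fin (suc (suc k)) → Fin (suc (suc k)) → ℤ) →
  det (suc (suc k)) M ≡
  sumℤ (suc (suc k)) (λ j → sumℤ (suc k) (λ l →
    (altSign j * altSign l) * ((M zero j * M (suc zero) (punchIn j l)) *
      det k (λ i x → M (suc (suc i)) (punchIn j (punchIn l x))))))
det-expand₂ k M = sumℤ-cong (suc (suc k)) λ j → begin
  altSign j * (M zero j * sumℤ (suc k) (t j))            ≡⟨ ℤₚ.*-assoc (altSign j) (M zero j) _ ⟨
  altSign j * M zero j * sumℤ (suc k) (t j)              ≡⟨ sumℤ-* (suc k) (altSign j * M zero j) (t j) ⟨
  sumℤ (suc k) (λ l → altSign j * M zero j * t j l)      ≡⟨ sumℤ-cong (suc k) (λ l → shuffle (altSign j) (M zero j) (altSign l) (M (suc zero) (punchIn j l)) (minor j l)) ⟩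
  _ ∎
  where
  minor t : Fin (suc (suc k)) → Fin (suc k) → ℤ
  minor j l = det k (λ i x → M (suc (suc i)) (punchIn j (punchIn l x)))
  t j l = altSign l * (M (suc zero) (punchIn j l) * minor j l)
  shuffle : ∀ a b c d e → a * b * (c * (d * e)) ≡ a * c * (b * d * e)
  shuffle = solve-∀

swap₀₁ : ∀ {k} → Fin (suc (suc k)) → Fin (suc (suc k))
swap₀₁ zero          = suc zero
swap₀₁ (suc zero)    = zero
swap₀₁ (suc (suc i)) = suc (suc i)

-- Expanded along its two top rows, the determinant is a sum over ordered pairs of distinct columns.
-- Reversing each pair exchanges the roles of the two rows, keeps the complementary minor and
-- negates the sign.
det-swap₀₁ : ∀ k (M : Fin (suc (suc k)) → Fin (suc (suc k)) → ℤ) →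
  det (suc (suc k)) (M ∘ swap₀₁) ≡ - det (suc (suc k)) M
det-swap₀₁ k M = begin
  det (suc (suc k)) (M ∘ swap₀₁)                       ≡⟨ det-expand₂ k (M ∘ swap₀₁) ⟩
  sumℤ (suc (suc k)) (λ j → sumℤ (suc k) (H j))        ≡⟨ sumℤ-flip (suc k) H ⟩
  sumℤ (suc (suc k)) (λ j → sumℤ (suc k) (λ l → H (flip₁ j l) (flip₂ j l)))
    ≡⟨ sumℤ-cong (suc (suc k)) (λ j → trans (sumℤ-cong (suc k) (H-flip j)) (sumℤ-neg (suc k) (G j))) ⟩
  sumℤ (suc (suc k)) (λ j → - sumℤ (suc k) (G j))    ≡⟨ sumℤ-neg (suc (suc k)) (λ j → sumℤ (suc k) (G j)) ⟩
  - sumℤ (suc (suc k)) (λ j → sumℤ (suc k) (G j))    ≡⟨ cong -_ (det-expand₂ k M) ⟨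
  - det (suc (suc k)) M                              ∎
  where
  minor : Fin (suc (suc k)) → Fin (suc k) → ℤ
  minor j l = det k (λ i x → M (suc (suc i)) (punchIn j (punchIn l x)))
  G H : Fin (suc (suc k)) → Fin (suc k) → ℤ
  G j l = (altSign j * altSign l) * ((M zero j * M (suc zero) (punchIn j l)) * minor j l)
  H j l = (altSign j * altSign l) * ((M (suc zero) j * M zero (punchIn j l)) * minor j l)
  shuffle : ∀ s a b d → (- s) * ((a * b) * d) ≡ - (s * ((b * a) * d))
  shuffle = solve-∀
  H-flip : ∀ j l → H (flip₁ j l) (flip₂ j l) ≡ - G j l
  H-flip j l = begin
    H (flip₁ j l) (flip₂ j l)
      ≡⟨ cong₂ _*_ (altSign-flip j l)
           (cong₂ _*_ (cong₂ _*_ (cong (M (suc zero)) (flip₁≡ j l)) (cong (M zero) (punchIn-flip j l)))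
                        (det-cong k (λ i x → cong (M (suc (suc i))) (punchIn-punchIn-flip j l x)))) ⟩
    (- (altSign j * altSign l)) * ((M (suc zero) (punchIn j l) * M zero j) * minor j l)
      ≡⟨ shuffle (altSign j * altSign l) (M (suc zero) (punchIn j l)) (M zero j) (minor j l) ⟩
    - G j l ∎

≡-neg⇒≡0 : ∀ {x} → x ≡ - x → x ≡ 0ℤ
≡-neg⇒≡0 {ℤ.+ zero} e = refl

neg≡0⇒≡0 : ∀ {x} → - x ≡ 0ℤ → x ≡ 0ℤ
neg≡0⇒≡0 {ℤ.+ zero} e = refl

-- If the equal rows are the two top ones, swapping them shows that the determinant is its own
-- negative. Otherwise a swap of the two top rows puts both equal rows below the first, so every
-- minor of the expansion vanishes by induction.
det-equalRows : ∀ k (M : Fin (suc k) → Fin (suc k) → ℤ) p →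
  (∀ x → M zero x ≡ M (suc p) x) → det (suc k) M ≡ 0ℤ
det-equalRows (suc k) M zero e =
  ≡-neg⇒≡0 (trans (det-cong (suc (suc k)) swapped) (det-swap₀₁ k M))
  where
  swapped : ∀ i x → M i x ≡ M (swap₀₁ i) x
  swapped zero          x = e x
  swapped (suc zero)    x = sym (e x)
  swapped (suc (suc i)) x = refl
det-equalRows (suc k) M (suc p) e = neg≡0⇒≡0 (trans (sym (det-swap₀₁ k M)) (sumℤ-zero (suc (suc k)) λ j →
  trans (cong (λ t → altSign j * (M (suc zero) j * t))
              (det-equalRows k (λ i x → M (swap₀₁ (suc i)) (punchIn j x)) p (λ x → e (punchIn j x))))
        (a*[b*0] (altSign j) (M (suc zero) j))))
  where
  a*[b*0] : ∀ a b → a * (b * 0ℤ) ≡ 0ℤ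
  a*[b*0] = solve-∀

moveToFront : ∀ {k} → Fin (suc k) → Fin (suc k) → Fin (suc k)
moveToFront p zero    = p
moveToFront p (suc i) = punchIn p i

-- Row `suc p` is first moved to the top of the rows below the first, which acts on the minors of
-- the expansion, and then swapped with the first row.
det-moveToFront : ∀ k (M : Fin (suc k) → Fin (suc k) → ℤ) p →
  det (suc k) (M ∘ moveToFront p) ≡ altSign p * det (suc k) M
det-moveToFront k M zero = trans (det-cong (suc k) fixed) (sym (ℤₚ.*-identityˡ _))
  where
  fixed : ∀ i x → M (moveToFront zero i) x ≡ M i x
  fixed zero    x = refl
  fixed (suc i) x = refl
det-moveToFront (suc k) M (suc p) = begin
  det (suc (suc k)) (M ∘ moveToFront (suc p))
    ≡⟨ det-cong (suc (suc k)) (λ i x → cong (λ r → M r x) (factor i)) ⟩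
  det (suc (suc k)) (N ∘ swap₀₁)             ≡⟨ det-swap₀₁ k N ⟩
  - det (suc (suc k)) N                    ≡⟨ cong -_ (sumℤ-cong (suc (suc k)) step) ⟩
  - sumℤ (suc (suc k)) (λ j → altSign p * (altSign j * (M zero j * minor j)))
    ≡⟨ cong -_ (sumℤ-* (suc (suc k)) (altSign p) (λ j → altSign j * (M zero j * minor j))) ⟩
  - (altSign p * det (suc (suc k)) M)    ≡⟨ ℤₚ.neg-distribˡ-* (altSign p) _ ⟩
  (- altSign p) * det (suc (suc k)) M    ≡⟨ cong (ℤ._* det (suc (suc k)) M) (altSign-suc p) ⟨
  altSign (suc p) * det (suc (suc k)) M    ∎
  where
  keep₀ : Fin (suc (suc k)) → Fin (suc (suc k))
  keep₀ zero    = zero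
  keep₀ (suc i) = suc (moveToFront p i)
  N = M ∘ keep₀
  minor : Fin (suc (suc k)) → ℤ
  minor j = det (suc k) (λ i x → M (suc i) (punchIn j x))
  factor : ∀ i → moveToFront (suc p) i ≡ keep₀ (swap₀₁ i)
  factor zero          = refl
  factor (suc zero)    = refl
  factor (suc (suc i)) = refl
  shuffle : ∀ a b c d → a * (b * (c * d)) ≡ c * (a * (b * d))
  shuffle = solve-∀
  step : ∀ j → altSign j * (M zero j * det (suc k) (λ i x → N (suc i) (punchIn j x)))
             ≡ altSign p * (altSign j * (M zero j * minor j))
  step j = trans
    (cong (λ t → altSign j * (M zero j * t)) (det-moveToFront k (λ i x → M (suc i) (punchIn j x)) p))
    (shuffle (altSign j) (M zero j) (altSign p) (minor j))

private
  corner : ∀ {k} → (Fin (suc (suc k)) → Fin (suc (suc k)) → ℤ) → ℤ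
  corner {k} M = 1ℤ * (M zero zero * det (suc k) (λ i x → M (suc i) (suc x)))

  minor₂ : ∀ {k} → (Fin (suc (suc k)) → Fin (suc (suc k)) → ℤ) → Fin (suc k) → Fin (suc k) → ℤ
  minor₂ {k} M j i = det k (λ x y → M (suc (punchIn i x)) (suc (punchIn j y)))

  term₂ : ∀ {k} → (Fin (suc (suc k)) → Fin (suc (suc k)) → ℤ) → Fin (suc k) → Fin (suc k) → ℤ
  term₂ M j i = (- (altSign j * altSign i)) * ((M zero (suc j) * M (suc i) zero) * minor₂ M j i)

-- Expanding along the first row, and then every minor but one along its first column,
-- gives an expression that is symmetric in rows and columns.
det-expand-hook : ∀ k →
  (∀ N → det k (λ i j → N j i) ≡ det k N) →
  (∀ N → det (suc k) (λ i j → N j i) ≡ det (suc k) N) →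
  ∀ M → det (suc (suc k)) M ≡ corner M + sumℤ (suc k) (λ j → sumℤ (suc k) (term₂ M j))
det-expand-hook k transpose transpose′ M = cong (corner M +_) (sumℤ-cong (suc k) λ j → begin
  altSign (suc j) * (M zero (suc j) * det (suc k) (λ i x → M (suc i) (punchIn (suc j) x)))
    ≡⟨ ℤₚ.*-assoc (altSign (suc j)) (M zero (suc j)) _ ⟨
  altSign (suc j) * M zero (suc j) * det (suc k) (λ i x → M (suc i) (punchIn (suc j) x))
    ≡⟨ cong₂ (λ s t → s * M zero (suc j) * t) (altSign-suc j)
         (sym (transpose′ (λ i x → M (suc i) (punchIn (suc j) x)))) ⟩
  - altSign j * M zero (suc j) * sumℤ (suc k) (inner j)
    ≡⟨ sumℤ-* (suc k) (- altSign j * M zero (suc j)) (inner j) ⟨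
  sumℤ (suc k) (λ i → - altSign j * M zero (suc j) * inner j i)
    ≡⟨ sumℤ-cong (suc k) (λ i → trans
         (cong (λ t → - altSign j * M zero (suc j) * (altSign i * (M (suc i) zero * t)))
               (transpose (λ x y → M (suc (punchIn i x)) (suc (punchIn j y)))))
         (shuffle (altSign j) (M zero (suc j)) (altSign i) (M (suc i) zero) (minor₂ M j i))) ⟩
  sumℤ (suc k) (term₂ M j) ∎)
  where
  inner : Fin (suc k) → Fin (suc k) → ℤ
  inner j i = altSign i * (M (suc i) zero * det k (λ y x → M (suc (punchIn i x)) (suc (punchIn j y))))
  shuffle : ∀ a b c d e → (- a * b) * (c * (d * e)) ≡ (- (a * c)) * ((b * d) * e)
  shuffle = solve-∀

-- `det` expands along rows whereas bases change by columns; this carries the row lemmas over to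
-- columns. The hook expansion consumes the claim at two smaller sizes, hence two base cases.
det-transpose : ∀ k (M : Fin k → Fin k → ℤ) → det k (λ i j → M j i) ≡ det k M
det-transpose zero          M = refl
det-transpose (suc zero)    M = refl
det-transpose (suc (suc k)) M = let expand = det-expand-hook k (det-transpose k) (det-transpose (suc k)) in begin
  det (suc (suc k)) Mᵀ                                       ≡⟨ expand Mᵀ ⟩
  corner Mᵀ + sumℤ (suc k) (λ j → sumℤ (suc k) (term₂ Mᵀ j))
    ≡⟨ cong₂ _+_ (cong (λ t → 1ℤ * (M zero zero * t)) (det-transpose (suc k) (λ i x → M (suc i) (suc x))))
         (trans (sumℤ-swap (suc k) (suc k) (term₂ Mᵀ))
                (sumℤ-cong (suc k) λ i → sumℤ-cong (suc k) λ j → term₂-transpose i j)) ⟩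
  corner M + sumℤ (suc k) (λ j → sumℤ (suc k) (term₂ M j))   ≡⟨ expand M ⟨
  det (suc (suc k)) M                                        ∎
  where
  Mᵀ : Fin (suc (suc k)) → Fin (suc (suc k)) → ℤ
  Mᵀ i j = M j i
  swapFactors : ∀ a b c d e → (- (a * b)) * ((c * d) * e) ≡ (- (b * a)) * ((d * c) * e)
  swapFactors = solve-∀
  term₂-transpose : ∀ i j → term₂ Mᵀ j i ≡ term₂ M i j
  term₂-transpose i j = trans
    (cong (λ t → (- (altSign j * altSign i)) * ((M (suc j) zero * M zero (suc i)) * t))
          (det-transpose k (λ x y → M (suc (punchIn j x)) (suc (punchIn i y)))))
    (swapFactors (altSign j) (altSign i) (M (suc j) zero) (M zero (suc i)) (minor₂ M i j))

-- Rational row spaces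

private
  -- `toℚ z` is by definition `fromℚᵘ` of the fraction z over 1, so arithmetic with embedded
  -- integers can be done on unnormalised fractions, where no common factor is cancelled.
  fromℚᵘ-+ : ∀ p q → ℚ.fromℚᵘ p ℚ.+ ℚ.fromℚᵘ q ≡ ℚ.fromℚᵘ (p ℚᵘ.+ q)
  fromℚᵘ-+ p q = ℚₚ.toℚᵘ-injective (ℚᵘₚ.≃-trans (ℚₚ.toℚᵘ-homo-+ (ℚ.fromℚᵘ p) (ℚ.fromℚᵘ q))
    (ℚᵘₚ.≃-trans (ℚᵘₚ.+-cong (ℚₚ.toℚᵘ-fromℚᵘ p) (ℚₚ.toℚᵘ-fromℚᵘ q)) (ℚᵘₚ.≃-sym (ℚₚ.toℚᵘ-fromℚᵘ (p ℚᵘ.+ q)))))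

  fromℚᵘ-* : ∀ p q → ℚ.fromℚᵘ p ℚ.* ℚ.fromℚᵘ q ≡ ℚ.fromℚᵘ (p ℚᵘ.* q)
  fromℚᵘ-* p q = ℚₚ.toℚᵘ-injective (ℚᵘₚ.≃-trans (ℚₚ.toℚᵘ-homo-* (ℚ.fromℚᵘ p) (ℚ.fromℚᵘ q))
    (ℚᵘₚ.≃-trans (ℚᵘₚ.*-cong (ℚₚ.toℚᵘ-fromℚᵘ p) (ℚₚ.toℚᵘ-fromℚᵘ q)) (ℚᵘₚ.≃-sym (ℚₚ.toℚᵘ-fromℚᵘ (p ℚᵘ.* q)))))

toℚ-+ : ∀ a b → toℚ (a + b) ≡ toℚ a ℚ.+ toℚ b
toℚ-+ a b = sym (trans (fromℚᵘ-+ (mkℚᵘ a 0) (mkℚᵘ b 0)) (ℚₚ.fromℚᵘ-cong {mkℚᵘ a 0 ℚᵘ.+ mkℚᵘ b 0} {mkℚᵘ (a + b) 0} (*≡* (unit a b))))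
  where
  unit : ∀ a b → (a * 1ℤ + b * 1ℤ) * 1ℤ ≡ (a + b) * 1ℤ
  unit = solve-∀

toℚ-* : ∀ a b → toℚ (a * b) ≡ toℚ a ℚ.* toℚ b
toℚ-* a b = sym (fromℚᵘ-* (mkℚᵘ a 0) (mkℚᵘ b 0))

toℚ-injective : ∀ {a b} → toℚ a ≡ toℚ b → a ≡ b
toℚ-injective {a} {b} e with ℚₚ.fromℚᵘ-injective {mkℚᵘ a 0} {mkℚᵘ b 0} e
... | *≡* a1≡b1 = trans (sym (ℤₚ.*-identityʳ a)) (trans a1≡b1 (ℤₚ.*-identityʳ b))

sumℚ≡sum : ∀ k (g : Fin k → ℚ) → sumℚ k g ≡ ℚ-Sum.sum g
sumℚ≡sum zero    g = refl
sumℚ≡sum (suc k) g = cong (g zero ℚ.+_) (sumℚ≡sum k (g ∘ suc))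

toℚ-sum : ∀ k (g : Fin k → ℤ) → toℚ (sumℤ k g) ≡ ℚ-Sum.sum (toℚ ∘ g)
toℚ-sum zero    g = refl
toℚ-sum (suc k) g = trans (toℚ-+ (g zero) (sumℤ k (g ∘ suc))) (cong (toℚ (g zero) ℚ.+_) (toℚ-sum k (g ∘ suc)))

module _ {r n} (A : Mat r n) where

  inRowSpace-+ : ∀ {P Q} → InRowSpace A P → InRowSpace A Q → InRowSpace A (λ x → P x + Q x)
  inRowSpace-+ {P} {Q} (y , eP) (y′ , eQ) = (λ i → y i ℚ.+ y′ i) , λ x → begin
    sumℚ r (λ i → (y i ℚ.+ y′ i) ℚ.* toℚ (A i x))             ≡⟨ sumℚ≡sum r _ ⟩
    sum (λ i → (y i ℚ.+ y′ i) ℚ.* toℚ (A i x))                ≡⟨ sum-cong-≗ (λ i → ℚₚ.*-distribʳ-+ (toℚ (A i x)) (y i) (y′ i)) ⟩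
    sum (λ i → y i ℚ.* toℚ (A i x) ℚ.+ y′ i ℚ.* toℚ (A i x))  ≡⟨ ∑-distrib-+ (λ i → y i ℚ.* toℚ (A i x)) _ ⟩
    sum (λ i → y i ℚ.* toℚ (A i x)) ℚ.+ sum (λ i → y′ i ℚ.* toℚ (A i x))
      ≡⟨ cong₂ ℚ._+_ (trans (sym (sumℚ≡sum r _)) (eP x)) (trans (sym (sumℚ≡sum r _)) (eQ x)) ⟩
    toℚ (P x) ℚ.+ toℚ (Q x)                                   ≡⟨ toℚ-+ (P x) (Q x) ⟨
    toℚ (P x + Q x)                                           ∎
    where open ℚ-Sum

  inRowSpace-scale : ∀ c {P} → InRowSpace A P → InRowSpace A (λ x → c * P x)
  inRowSpace-scale c {P} (y , e) = (λ i → toℚ c ℚ.* y i) , λ x → begin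
    sumℚ r (λ i → toℚ c ℚ.* y i ℚ.* toℚ (A i x))     ≡⟨ sumℚ≡sum r _ ⟩
    sum (λ i → toℚ c ℚ.* y i ℚ.* toℚ (A i x))        ≡⟨ sum-cong-≗ (λ i → ℚₚ.*-assoc (toℚ c) (y i) (toℚ (A i x))) ⟩
    sum (λ i → toℚ c ℚ.* (y i ℚ.* toℚ (A i x)))      ≡⟨ *-distribˡ-sum (toℚ c) (λ i → y i ℚ.* toℚ (A i x)) ⟨
    toℚ c ℚ.* sum (λ i → y i ℚ.* toℚ (A i x))        ≡⟨ cong (toℚ c ℚ.*_) (trans (sym (sumℚ≡sum r _)) (e x)) ⟩
    toℚ c ℚ.* toℚ (P x)                              ≡⟨ toℚ-* c (P x) ⟨
    toℚ (c * P x)                                    ∎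
    where open ℚ-Sum

  inRowSpace-combination : ∀ (y : Fin r → ℤ) {P} → (∀ x → sumℤ r (λ i → y i * A i x) ≡ P x) → InRowSpace A P
  inRowSpace-combination y {P} e = toℚ ∘ y , λ x → begin
    sumℚ r (λ i → toℚ (y i) ℚ.* toℚ (A i x))  ≡⟨ sumℚ≡sum r _ ⟩
    sum (λ i → toℚ (y i) ℚ.* toℚ (A i x))     ≡⟨ sum-cong-≗ (λ i → toℚ-* (y i) (A i x)) ⟨
    sum (λ i → toℚ (y i * A i x))             ≡⟨ toℚ-sum r (λ i → y i * A i x) ⟨
    toℚ (sumℤ r (λ i → y i * A i x))          ≡⟨ cong toℚ (e x) ⟩
    toℚ (P x)                                 ∎
    where open ℚ-Sum

  inKernel-+ : ∀ {P Q} → InKernel A P → InKernel A Q → InKernel A (λ x → P x + Q x)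
  inKernel-+ {P} {Q} p q i = begin
    sumℤ n (λ x → A i x * (P x + Q x))        ≡⟨ sumℤ-cong n (λ x → ℤₚ.*-distribˡ-+ (A i x) (P x) (Q x)) ⟩
    sumℤ n (λ x → A i x * P x + A i x * Q x)  ≡⟨ sumℤ-+ n (λ x → A i x * P x) (λ x → A i x * Q x) ⟩
    sumℤ n (λ x → A i x * P x) + sumℤ n (λ x → A i x * Q x)  ≡⟨ cong₂ _+_ (p i) (q i) ⟩
    0ℤ                                        ∎

  inKernel-scale : ∀ c {P} → InKernel A P → InKernel A (λ x → c * P x)
  inKernel-scale c {P} p i = begin
    sumℤ n (λ x → A i x * (c * P x))  ≡⟨ sumℤ-cong n (λ x → swap (A i x) c (P x)) ⟩
    sumℤ n (λ x → c * (A i x * P x))  ≡⟨ sumℤ-* n c (λ x → A i x * P x) ⟩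
    c * sumℤ n (λ x → A i x * P x)    ≡⟨ cong (c *_) (p i) ⟩
    c * 0ℤ                            ≡⟨ ℤₚ.*-zeroʳ c ⟩
    0ℤ                                ∎
    where
    swap : ∀ a b c → a * (b * c) ≡ b * (a * c)
    swap = solve-∀

  -- With Q = yA, the pairing of P and Q is y applied to AP, which is zero.
  kernel⊥rowSpace : ∀ {P Q} → InKernel A P → InRowSpace A Q → sumℤ n (λ x → P x * Q x) ≡ 0ℤ
  kernel⊥rowSpace {P} {Q} p (y , e) = toℚ-injective (begin
    toℚ (sumℤ n (λ x → P x * Q x))              ≡⟨ toℚ-sum n _ ⟩
    sum (λ x → toℚ (P x * Q x))                 ≡⟨ sum-cong-≗ expand ⟩
    sum (λ x → sum (λ i → y i ℚ.* toℚ (A i x * P x)))   ≡⟨ ∑-comm (λ x i → y i ℚ.* toℚ (A i x * P x)) ⟩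
    sum (λ i → sum (λ x → y i ℚ.* toℚ (A i x * P x)))   ≡⟨ sum-cong-≗ vanish ⟩
    sum {r} (λ i → ℚ.0ℚ)                        ≡⟨ sum-replicate-zero r ⟩
    ℚ.0ℚ                                        ∎)
    where
    open ℚ-Sum
    expand : ∀ x → toℚ (P x * Q x) ≡ sum (λ i → y i ℚ.* toℚ (A i x * P x))
    expand x = begin
      toℚ (P x * Q x)                                   ≡⟨ toℚ-* (P x) (Q x) ⟩
      toℚ (P x) ℚ.* toℚ (Q x)                           ≡⟨ ℚₚ.*-comm (toℚ (P x)) (toℚ (Q x)) ⟩
      toℚ (Q x) ℚ.* toℚ (P x)                           ≡⟨ cong (ℚ._* toℚ (P x)) (trans (sym (e x)) (sumℚ≡sum r _)) ⟩
      sum (λ i → y i ℚ.* toℚ (A i x)) ℚ.* toℚ (P x)     ≡⟨ *-distribʳ-sum (toℚ (P x)) (λ i → y i ℚ.* toℚ (A i x)) ⟩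
      sum (λ i → y i ℚ.* toℚ (A i x) ℚ.* toℚ (P x))     ≡⟨ sum-cong-≗ (λ i → trans (ℚₚ.*-assoc (y i) (toℚ (A i x)) (toℚ (P x))) (cong (y i ℚ.*_) (sym (toℚ-* (A i x) (P x))))) ⟩
      sum (λ i → y i ℚ.* toℚ (A i x * P x))             ∎
    vanish : ∀ i → sum (λ x → y i ℚ.* toℚ (A i x * P x)) ≡ ℚ.0ℚ
    vanish i = begin
      sum (λ x → y i ℚ.* toℚ (A i x * P x))   ≡⟨ *-distribˡ-sum (y i) (λ x → toℚ (A i x * P x)) ⟨
      y i ℚ.* sum (λ x → toℚ (A i x * P x))   ≡⟨ cong (y i ℚ.*_) (toℚ-sum n (λ x → A i x * P x)) ⟨
      y i ℚ.* toℚ (sumℤ n (λ x → A i x * P x)) ≡⟨ cong (λ t → y i ℚ.* toℚ t) (p i) ⟩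
      y i ℚ.* ℚ.0ℚ                            ≡⟨ ℚₚ.*-zeroʳ (y i) ⟩
      ℚ.0ℚ                                    ∎

-- Tableaux

IsTernary : ℤ → Set
IsTernary z = z ≡ ℤ.+ 1 ⊎ z ≡ ℤ.+ 0 ⊎ z ≡ -[1+ 0 ]

ternary-neg : ∀ {a} → IsTernary a → IsTernary (- a)
ternary-neg (inj₁ refl)        = inj₂ (inj₂ refl)
ternary-neg (inj₂ (inj₁ refl)) = inj₂ (inj₁ refl)
ternary-neg (inj₂ (inj₂ refl)) = inj₁ refl

ternary-* : ∀ {a b} → IsTernary a → IsTernary b → IsTernary (a * b)
ternary-* {b = b} (inj₁ refl)        t = subst IsTernary (sym (ℤₚ.*-identityˡ b)) t
ternary-* {b = b} (inj₂ (inj₁ refl)) t = inj₂ (inj₁ (ℤₚ.*-zeroˡ b))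
ternary-* {b = b} (inj₂ (inj₂ refl)) t = subst IsTernary (sym (ℤₚ.-1*i≡-i b)) (ternary-neg t)

altSign-ternary : ∀ {k} (i : Fin k) → IsTernary (altSign i)
altSign-ternary zero          = inj₁ refl
altSign-ternary (suc zero)    = inj₂ (inj₂ refl)
altSign-ternary (suc (suc i)) = altSign-ternary i

-- The incoming column goes to the front and not into slot i, so that the determinant can be
-- expanded along it at once. The factor `altSign i` in `tableau` pays for the move.
exchange : ∀ {r n} → (Fin r → Fin n) → Fin r → Fin n → Fin r → Fin n
exchange {suc r} κ i x zero    = x
exchange {suc r} κ i x (suc j) = κ (punchIn i j)

module Tableau {r n} (A : Mat r n) where

  columnDet : (Fin r → Fin n) → ℤ
  columnDet κ = det r (subMat A (λ i → i) κ)

  -- For a nonsingular choice of columns this is entry (i, x) of the inverse of the chosen square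
  -- submatrix times A, by Cramer's rule. The determinant is its own inverse there, so a product
  -- stands in place of a quotient.
  tableau : (Fin r → Fin n) → Fin r → Fin n → ℤ
  tableau κ i x = columnDet κ * (altSign i * columnDet (exchange κ i x))

module _ where
  open Tableau

  columnDet-exchange-self : ∀ {r n} (A : Mat r n) κ i →
    columnDet A (exchange κ i (κ i)) ≡ altSign i * columnDet A κ
  columnDet-exchange-self {suc r} A κ i = begin
    columnDet A (exchange κ i (κ i))                     ≡⟨ det-transpose (suc r) (subMat A (λ i → i) (exchange κ i (κ i))) ⟨
    det (suc r) (λ a b → A b (exchange κ i (κ i) a))     ≡⟨ det-cong (suc r) (λ a b → cong (A b) (front a)) ⟩
    det (suc r) (λ a b → A b (κ (moveToFront i a)))      ≡⟨ det-moveToFront r (λ a b → A b (κ a)) i ⟩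
    altSign i * det (suc r) (λ a b → A b (κ a))          ≡⟨ cong (altSign i *_) (det-transpose (suc r) (subMat A (λ i → i) κ)) ⟩
    altSign i * columnDet A κ                            ∎
    where
    front : ∀ a → exchange κ i (κ i) a ≡ κ (moveToFront i a)
    front zero    = refl
    front (suc a) = refl

  columnDet-exchange-other : ∀ {r n} (A : Mat r n) κ {i j} → i ≢ j →
    columnDet A (exchange κ i (κ j)) ≡ 0ℤ
  columnDet-exchange-other {suc zero} A κ {zero} {zero} i≢j = contradiction refl i≢j
  columnDet-exchange-other {suc (suc r)} A κ {i} {j} i≢j = trans
    (sym (det-transpose (suc (suc r)) (subMat A (λ i → i) (exchange κ i (κ j)))))
    (det-equalRows (suc r) (λ a b → A b (exchange κ i (κ j) a)) (punchOut i≢j)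
      (λ b → cong (A b ∘ κ) (sym (punchIn-punchOut i≢j))))

  -- Expand along the incoming column: the coefficients are cofactors of the other columns and do
  -- not depend on x. This is what puts the rows of the tableau into the row space.
  columnDet-exchange-linear : ∀ {r n} (A : Mat r n) κ i → ∃ λ (y : Fin r → ℤ) →
    ∀ x → sumℤ r (λ a → y a * A a x) ≡ columnDet A (exchange κ i x)
  columnDet-exchange-linear {suc r} A κ i = y , λ x → begin
    sumℤ (suc r) (λ a → y a * A a x)
      ≡⟨ sumℤ-cong (suc r) (λ a → swap (altSign a) (minor a) (A a x)) ⟩
    sumℤ (suc r) (λ a → altSign a * (A a x * minor a))
      ≡⟨⟩
    det (suc r) (λ a b → A b (exchange κ i x a))
      ≡⟨ det-transpose (suc r) (subMat A (λ i → i) (exchange κ i x)) ⟩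
    columnDet A (exchange κ i x) ∎
    where
    minor y : Fin (suc r) → ℤ
    minor a = det r (λ b c → A (punchIn a c) (κ (punchIn i b)))
    y a = altSign a * minor a
    swap : ∀ a b c → a * b * c ≡ a * (c * b)
    swap = solve-∀

  -- Take the columns x and `κ` of A and write row k once more on top. The resulting square matrix
  -- has two equal rows, and expanding its zero determinant along the top row is the claimed
  -- identity.
  cramer : ∀ {r n} (A : Mat r n) κ k x →
    columnDet A κ * A k x ≡ sumℤ r (λ i → A k (κ i) * (altSign i * columnDet A (exchange κ i x)))
  cramer {r} A κ k x = ℤₚ.i-j≡0⇒i≡j _ _ (begin
    columnDet A κ * A k x + - sumℤ r (λ i → A k (κ i) * (altSign i * d i))
      ≡⟨ cong₂ _+_ (swap (columnDet A κ) (A k x)) (sym (sumℤ-neg r (λ i → A k (κ i) * (altSign i * d i)))) ⟩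
    1ℤ * (A k x * columnDet A κ) + sumℤ r (λ i → - (A k (κ i) * (altSign i * d i)))
      ≡⟨ cong (1ℤ * (A k x * columnDet A κ) +_) (sumℤ-cong r λ i → begin
           - (A k (κ i) * (altSign i * d i))    ≡⟨ swap′ (A k (κ i)) (altSign i) (d i) ⟩
           - altSign i * (A k (κ i) * d i)      ≡⟨ cong₂ (λ s t → s * (A k (κ i) * t)) (altSign-suc i) (det-cong r (λ a b → cong (A a) (columns i b))) ⟨
           altSign (suc i) * (A k (κ i) * det r (λ a b → A a (κ⁺ (punchIn (suc i) b)))) ∎) ⟩
    det (suc r) M ≡⟨ det-equalRows r M k (λ _ → refl) ⟩
    0ℤ ∎)
    where
    d : Fin r → ℤ
    d i = columnDet A (exchange κ i x)
    κ⁺ : Fin (suc r) → Fin _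
    κ⁺ zero    = x
    κ⁺ (suc i) = κ i
    M : Fin (suc r) → Fin (suc r) → ℤ
    M zero    j = A k (κ⁺ j)
    M (suc a) j = A a (κ⁺ j)
    columns : ∀ i b → κ⁺ (punchIn (suc i) b) ≡ exchange κ i x b
    columns zero    zero    = refl
    columns zero    (suc b) = refl
    columns (suc i) zero    = refl
    columns (suc i) (suc b) = refl
    swap : ∀ a b → a * b ≡ 1ℤ * (b * a)
    swap = solve-∀
    swap′ : ∀ a b c → - (a * (b * c)) ≡ - b * (a * c)
    swap′ = solve-∀

-- Subsets given by decidable predicates

module _ {n} {S : Fin n → Set} (S? : Decidable S) where

  ∈-comprehension⁺ : ∀ {x} → S x → x ∈ tabulate (λ x → does (S? x))
  ∈-comprehension⁺ {x} s = lookup⇒[]= x _ (trans (lookup∘tabulate _ x) (dec-true (S? x) s))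

  ∈-comprehension⁻ : ∀ {x} → x ∈ tabulate (λ x → does (S? x)) → S x
  ∈-comprehension⁻ {x} x∈ with S? x | trans (sym (lookup∘tabulate (λ x → does (S? x)) x)) ([]=⇒lookup x∈)
  ... | yes s | _ = s

nonzero? : ∀ {n} (P : Chain n) → Decidable (λ x → P x ≢ 0ℤ)
nonzero? P x = ¬? (P x ℤ.≟ 0ℤ)

∈-supp⁺ : ∀ {n} (P : Chain n) {x} → P x ≢ 0ℤ → x ∈ supp P
∈-supp⁺ P = ∈-comprehension⁺ (nonzero? P)

∈-supp⁻ : ∀ {n} (P : Chain n) {x} → x ∈ supp P → P x ≢ 0ℤ
∈-supp⁻ P = ∈-comprehension⁻ (nonzero? P)

InImage : ∀ {r n} → (Fin r → Fin n) → Fin n → Set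
InImage κ x = ∃ λ j → κ j ≡ x

inImage? : ∀ {r n} (κ : Fin r → Fin n) → Decidable (InImage κ)
inImage? κ x = any? (λ j → κ j ≟ x)

image : ∀ {r n} → (Fin r → Fin n) → Subset n
image κ = tabulate (λ x → does (inImage? κ x))

exchange-new : ∀ {r n} (κ : Fin r → Fin n) i x → InImage (exchange κ i x) x
exchange-new {suc r} κ i x = zero , refl

exchange-old : ∀ {r n} (κ : Fin r → Fin n) {i j} x → i ≢ j → InImage (exchange κ i x) (κ j)
exchange-old {suc zero} κ {zero} {zero} x i≢j = contradiction refl i≢j
exchange-old {suc (suc r)} κ x i≢j = suc (punchOut i≢j) , cong κ (punchIn-punchOut i≢j)

exchange-image : ∀ {r n} (κ : Fin r → Fin n) {i x y} → InImage (exchange κ i x) y →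
  y ≡ x ⊎ ∃ λ j → i ≢ j × κ j ≡ y
exchange-image {suc r} κ (zero  , e) = inj₁ (sym e)
exchange-image {suc r} κ {i} (suc b , e) = inj₂ (punchIn i b , (λ i≡ → punchInᵢ≢i i b (sym i≡)) , e)

δ : ∀ {n} → Fin n → Fin n → ℤ
δ a b = if does (a ≟ b) then 1ℤ else 0ℤ

δ-refl : ∀ {n} (a : Fin n) → δ a a ≡ 1ℤ
δ-refl a = cong (if_then 1ℤ else 0ℤ) (dec-true (a ≟ a) refl)

δ-≢ : ∀ {n} {a b : Fin n} → a ≢ b → δ a b ≡ 0ℤ
δ-≢ {a = a} {b} a≢b = cong (if_then 1ℤ else 0ℤ) (dec-false (a ≟ b) a≢b)

sumℤ-δ : ∀ {n} (g : Fin n → ℤ) a → sumℤ n (λ y → g y * δ a y) ≡ g a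
sumℤ-δ {n} g a = begin
  sumℤ n (λ y → g y * δ a y)  ≡⟨ sumℤ-single n a (λ y y≢a → trans (cong (g y *_) (δ-≢ (y≢a ∘ sym))) (ℤₚ.*-zeroʳ (g y))) ⟩
  g a * δ a a                 ≡⟨ cong (g a *_) (δ-refl a) ⟩
  g a * 1ℤ                    ≡⟨ ℤₚ.*-identityʳ (g a) ⟩
  g a                         ∎

0≢1 : 0ℤ ≢ 1ℤ
0≢1 ()

-- Fundamental circuits and cocircuits of a totally unimodular matrix

module UnimodularTableau {r n} (A : Mat r n) (tu : TotallyUnimodular A) where
  open Tableau A public

  Nonsingular : (Fin r → Fin n) → Set
  Nonsingular κ = columnDet κ ≢ 0ℤ

  columnDet-square : ∀ {κ} → Nonsingular κ → columnDet κ * columnDet κ ≡ 1ℤ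
  columnDet-square {κ} κ≢0 with columnDet κ | tu r (λ i → i) κ
  ... | _ | inj₁ refl        = refl
  ... | _ | inj₂ (inj₁ refl) = contradiction refl κ≢0
  ... | _ | inj₂ (inj₂ refl) = refl

  tableau-ternary : ∀ κ i x → IsTernary (tableau κ i x)
  tableau-ternary κ i x =
    ternary-* (tu r (λ i → i) κ) (ternary-* (altSign-ternary i) (tu r (λ i → i) (exchange κ i x)))

  tableau-diagonal : ∀ {κ} → Nonsingular κ → ∀ i → tableau κ i (κ i) ≡ 1ℤ
  tableau-diagonal {κ} ns i = begin
    d * (s * columnDet (exchange κ i (κ i))) ≡⟨ cong (λ t → d * (s * t)) (columnDet-exchange-self A κ i) ⟩
    d * (s * (s * d))                        ≡⟨ shuffle d s ⟩
    (s * s) * (d * d)                        ≡⟨ cong₂ _*_ (altSign-square i) (columnDet-square ns) ⟩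
    1ℤ                                       ∎
    where
    d = columnDet κ
    s = altSign i
    shuffle : ∀ d s → d * (s * (s * d)) ≡ (s * s) * (d * d)
    shuffle = solve-∀

  tableau-offDiagonal : ∀ κ {i j} → i ≢ j → tableau κ i (κ j) ≡ 0ℤ
  tableau-offDiagonal κ {i} i≢j = trans
    (cong (λ t → columnDet κ * (altSign i * t)) (columnDet-exchange-other A κ i≢j))
    (annihilate (columnDet κ) (altSign i))
    where
    annihilate : ∀ a b → a * (b * 0ℤ) ≡ 0ℤ
    annihilate = solve-∀

  nonsingular-injective : ∀ {κ} → Nonsingular κ → Injective _≡_ _≡_ κ
  nonsingular-injective {κ} ns {i} {j} κi≡κj with i ≟ j
  ... | yes i≡j = i≡j
  ... | no  i≢j = contradiction
    (trans (sym (tableau-offDiagonal κ i≢j)) (trans (cong (tableau κ i) (sym κi≡κj)) (tableau-diagonal ns i))) 0≢1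

  exchange-nonsingular : ∀ κ i x → tableau κ i x ≢ 0ℤ → Nonsingular (exchange κ i x)
  exchange-nonsingular κ i x t≢0 e = t≢0
    (trans (cong (λ t → columnDet κ * (altSign i * t)) e) (annihilate (columnDet κ) (altSign i)))
    where
    annihilate : ∀ a b → a * (b * 0ℤ) ≡ 0ℤ
    annihilate = solve-∀

  tableau-rowSpace : ∀ κ i → InRowSpace A (tableau κ i)
  tableau-rowSpace κ i with y , e ← columnDet-exchange-linear A κ i =
    inRowSpace-scale A (columnDet κ) (inRowSpace-scale A (altSign i) (inRowSpace-combination A y e))

  tableau-expansion : ∀ {κ} → Nonsingular κ → ∀ k x →
    A k x ≡ sumℤ r (λ i → A k (κ i) * tableau κ i x)
  tableau-expansion {κ} ns k x = begin
    A k x                                             ≡⟨ ℤₚ.*-identityˡ (A k x) ⟨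
    1ℤ * A k x                                        ≡⟨ cong (_* A k x) (columnDet-square ns) ⟨
    d * d * A k x                                     ≡⟨ ℤₚ.*-assoc d d (A k x) ⟩
    d * (d * A k x)                                   ≡⟨ cong (d *_) (cramer A κ k x) ⟩
    d * sumℤ r (λ i → A k (κ i) * e i)                ≡⟨ sumℤ-* r d (λ i → A k (κ i) * e i) ⟨
    sumℤ r (λ i → d * (A k (κ i) * e i))              ≡⟨ sumℤ-cong r (λ i → swap d (A k (κ i)) (e i)) ⟩
    sumℤ r (λ i → A k (κ i) * tableau κ i x)          ∎
    where
    d = columnDet κ
    e : Fin r → ℤ
    e i = altSign i * columnDet (exchange κ i x)
    swap : ∀ a b c → a * (b * c) ≡ b * (a * c)
    swap = solve-∀

  -- For x outside the basis this is the signed fundamental circuit of x: the unit vector at x minus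
  -- the expansion of column x in the basis columns.
  fundamentalChain : (Fin r → Fin n) → Fin n → Chain n
  fundamentalChain κ x y = δ x y + - sumℤ r (λ i → tableau κ i x * δ (κ i) y)

  fundamentalChain-kernel : ∀ {κ} → Nonsingular κ → ∀ x → InKernel A (fundamentalChain κ x)
  fundamentalChain-kernel {κ} ns x k = begin
    sumℤ n (λ y → A k y * fundamentalChain κ x y)
      ≡⟨ sumℤ-cong n (λ y → distrib (A k y) (δ x y) (c y)) ⟩
    sumℤ n (λ y → A k y * δ x y + - (A k y * c y))
      ≡⟨ sumℤ-+ n (λ y → A k y * δ x y) (λ y → - (A k y * c y)) ⟩
    sumℤ n (λ y → A k y * δ x y) + sumℤ n (λ y → - (A k y * c y))
      ≡⟨ cong₂ _+_ (sumℤ-δ (A k) x) (sumℤ-neg n (λ y → A k y * c y)) ⟩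
    A k x + - sumℤ n (λ y → A k y * c y)
      ≡⟨ cong (λ t → A k x + - t) (begin
           sumℤ n (λ y → A k y * c y)
             ≡⟨ sumℤ-cong n (λ y → sumℤ-* r (A k y) (λ i → tableau κ i x * δ (κ i) y)) ⟨
           sumℤ n (λ y → sumℤ r (λ i → A k y * (tableau κ i x * δ (κ i) y)))
             ≡⟨ sumℤ-swap n r (λ y i → A k y * (tableau κ i x * δ (κ i) y)) ⟩
           sumℤ r (λ i → sumℤ n (λ y → A k y * (tableau κ i x * δ (κ i) y)))
             ≡⟨ sumℤ-cong r (λ i → trans
                  (sumℤ-cong n (λ y → sym (ℤₚ.*-assoc (A k y) (tableau κ i x) (δ (κ i) y))))
                  (sumℤ-δ (λ y → A k y * tableau κ i x) (κ i))) ⟩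
           sumℤ r (λ i → A k (κ i) * tableau κ i x)
             ≡⟨ tableau-expansion ns k x ⟨
           A k x ∎) ⟩
    A k x + - A k x ≡⟨ ℤₚ.+-inverseʳ (A k x) ⟩
    0ℤ ∎
    where
    c : Fin n → ℤ
    c y = sumℤ r (λ i → tableau κ i x * δ (κ i) y)
    distrib : ∀ a b c → a * (b + - c) ≡ a * b + - (a * c)
    distrib = solve-∀

  module _ {κ : Fin r → Fin n} (ns : Nonsingular κ) {x} (x∉κ : ¬ InImage κ x) where

    fundamentalChain-basic : ∀ j → fundamentalChain κ x (κ j) ≡ - tableau κ j x
    fundamentalChain-basic j = begin
      δ x (κ j) + - sumℤ r (λ i → tableau κ i x * δ (κ i) (κ j))
        ≡⟨ cong₂ (λ s t → s + - t) (δ-≢ (λ x≡κj → x∉κ (j , sym x≡κj))) (sumℤ-single r j λ i i≢j →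
             trans (cong (tableau κ i x *_) (δ-≢ (i≢j ∘ nonsingular-injective ns))) (ℤₚ.*-zeroʳ (tableau κ i x))) ⟩
      0ℤ + - (tableau κ j x * δ (κ j) (κ j)) ≡⟨ ℤₚ.+-identityˡ _ ⟩
      - (tableau κ j x * δ (κ j) (κ j))      ≡⟨ cong (λ t → - (tableau κ j x * t)) (δ-refl (κ j)) ⟩
      - (tableau κ j x * 1ℤ)                 ≡⟨ cong -_ (ℤₚ.*-identityʳ (tableau κ j x)) ⟩
      - tableau κ j x                        ∎

    private
      nonbasic : ∀ {y} → ¬ InImage κ y → fundamentalChain κ x y ≡ δ x y
      nonbasic {y} y∉κ = trans
        (cong (λ t → δ x y + - t) (sumℤ-zero r λ i →
          trans (cong (tableau κ i x *_) (δ-≢ (λ e → y∉κ (i , e)))) (ℤₚ.*-zeroʳ (tableau κ i x))))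
        (ℤₚ.+-identityʳ _)

    fundamentalChain-self : fundamentalChain κ x x ≡ 1ℤ
    fundamentalChain-self = trans (nonbasic x∉κ) (δ-refl x)

    fundamentalChain-nonbasic : ∀ {y} → ¬ InImage κ y → x ≢ y → fundamentalChain κ x y ≡ 0ℤ
    fundamentalChain-nonbasic y∉κ x≢y = trans (nonbasic y∉κ) (δ-≢ x≢y)

    fundamentalChain-support : ∀ {y} → fundamentalChain κ x y ≢ 0ℤ →
      x ≡ y ⊎ ∃ λ j → κ j ≡ y × tableau κ j x ≢ 0ℤ
    fundamentalChain-support {y} Qy≢0 = by-cases (x ≟ y) (inImage? κ y)
      where
      by-cases : Dec (x ≡ y) → Dec (InImage κ y) → x ≡ y ⊎ ∃ λ j → κ j ≡ y × tableau κ j x ≢ 0ℤ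
      by-cases (yes x≡y) _          = inj₁ x≡y
      by-cases (no x≢y)  (no y∉κ)   = contradiction (fundamentalChain-nonbasic y∉κ x≢y) Qy≢0
      by-cases (no x≢y)  (yes (j , refl)) =
        inj₂ (j , refl , λ t≡0 → Qy≢0 (trans (fundamentalChain-basic j) (cong -_ t≡0)))

    fundamentalChain-simple : Simple (fundamentalChain κ x)
    fundamentalChain-simple y = by-cases (x ≟ y) (inImage? κ y)
      where
      by-cases : Dec (x ≡ y) → Dec (InImage κ y) → IsTernary (fundamentalChain κ x y)
      by-cases _ (yes (j , refl)) =
        subst IsTernary (sym (fundamentalChain-basic j)) (ternary-neg (tableau-ternary κ j x))
      by-cases (yes refl) (no y∉κ) = inj₁ fundamentalChain-self
      by-cases (no x≢y)   (no y∉κ) = inj₂ (inj₁ (fundamentalChain-nonbasic y∉κ x≢y))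

  -- Among the basis elements, row i of the tableau is nonzero only at `κ i`, so pairing it with z
  -- isolates the value of z there.
  kernel-offBasis : ∀ {κ z} → Nonsingular κ → InKernel A z →
    (∀ x → z x ≢ 0ℤ → InImage κ x) → ∀ x → z x ≡ 0ℤ
  kernel-offBasis {κ} {z} ns z∈ker supported x = decidable-stable (z x ℤ.≟ 0ℤ) λ zx≢0 →
    let i , κi≡x = supported x zx≢0 in zx≢0 (trans (cong z (sym κi≡x)) (basic i))
    where
    basic : ∀ i → z (κ i) ≡ 0ℤ
    basic i = begin
      z (κ i)                             ≡⟨ ℤₚ.*-identityʳ _ ⟨
      z (κ i) * 1ℤ                        ≡⟨ cong (z (κ i) *_) (tableau-diagonal ns i) ⟨
      z (κ i) * tableau κ i (κ i)         ≡⟨ sumℤ-single n (κ i) others ⟨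
      sumℤ n (λ y → z y * tableau κ i y)  ≡⟨ kernel⊥rowSpace A z∈ker (tableau-rowSpace κ i) ⟩
      0ℤ                                  ∎
      where
      others : ∀ y → y ≢ κ i → z y * tableau κ i y ≡ 0ℤ
      others y y≢κi with z y ℤ.≟ 0ℤ
      ... | yes zy≡0 = trans (cong (_* tableau κ i y) zy≡0) (ℤₚ.*-zeroˡ (tableau κ i y))
      ... | no  zy≢0 with j , refl ← supported y zy≢0 =
        trans (cong (z y *_) (tableau-offDiagonal κ (λ i≡j → y≢κi (cong κ (sym i≡j))))) (ℤₚ.*-zeroʳ (z y))

  -- Dual to `kernel-offBasis`: the fundamental circuit of x meets the complement of the basis only
  -- in x, so pairing it with w isolates `w x`.
  rowSpace-onBasis : ∀ {κ w} → Nonsingular κ → InRowSpace A w →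
    (∀ i → w (κ i) ≡ 0ℤ) → ∀ x → w x ≡ 0ℤ
  rowSpace-onBasis {κ} {w} ns w∈row vanishes x with inImage? κ x
  ... | yes (i , refl) = vanishes i
  ... | no  x∉κ = begin
    w x                                        ≡⟨ ℤₚ.*-identityˡ _ ⟨
    1ℤ * w x                                   ≡⟨ cong (_* w x) (fundamentalChain-self ns x∉κ) ⟨
    fundamentalChain κ x x * w x               ≡⟨ sumℤ-single n x others ⟨
    sumℤ n (λ y → fundamentalChain κ x y * w y)  ≡⟨ kernel⊥rowSpace A (fundamentalChain-kernel ns x) w∈row ⟩
    0ℤ                                         ∎
    where
    others : ∀ y → y ≢ x → fundamentalChain κ x y * w y ≡ 0ℤ
    others y y≢x with inImage? κ y
    ... | yes (i , refl) = trans (cong (fundamentalChain κ x y *_) (vanishes i)) (ℤₚ.*-zeroʳ (fundamentalChain κ x y))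
    ... | no y∉κ = trans (cong (_* w y) (fundamentalChain-nonbasic ns x∉κ y∉κ (y≢x ∘ sym))) (ℤₚ.*-zeroˡ (w y))

  image-isBasis : ∀ {κ} → Nonsingular κ → IsBasis A (image κ)
  image-isBasis {κ} ns = κ , nonsingular-injective ns
    , (λ j → ∈-comprehension⁺ (inImage? κ) (j , refl)) , (λ x → ∈-comprehension⁻ (inImage? κ)) , ns

  module _ {S : Fin n → Set} (S? : Decidable S) where

    private
      cost : Fin n → ℕ
      cost x = if does (S? x) then 0 else 1

      weight : ∀ {k} → (Fin k → Fin n) → ℕ
      weight κ = ℕ-Sum.sum (cost ∘ κ)

      exchange-weight : ∀ {k} (κ : Fin k → Fin n) i {x} → S x → ¬ S (κ i) → weight (exchange κ i x) ℕ.< weight κ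
      exchange-weight {suc k} κ i {x} x∈S κi∉S = ℕₚ.≤-reflexive (begin
        suc (cost x ℕ.+ weight (κ ∘ punchIn i)) ≡⟨ cong (λ t → suc (t ℕ.+ weight (κ ∘ punchIn i))) x-inside ⟩
        1 ℕ.+ weight (κ ∘ punchIn i)               ≡⟨ cong (ℕ._+ weight (κ ∘ punchIn i)) κi-outside ⟨
        cost (κ i) ℕ.+ weight (κ ∘ punchIn i)   ≡⟨ ℕ-Sum.sum-remove (cost ∘ κ) ⟨
        weight κ                                   ∎)
        where
        x-inside : cost x ≡ 0
        x-inside = cong (if_then 0 else 1) (dec-true (S? x) x∈S)
        κi-outside : cost (κ i) ≡ 1
        κi-outside = cong (if_then 0 else 1) (dec-false (S? (κ i)) κi∉S)

    -- A local form of having as many basis elements in S as possible: no single exchange trades a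
    -- basis element outside S for one in S.
    Saturated : (Fin r → Fin n) → Set
    Saturated κ = ∀ i x → ¬ S (κ i) → S x → tableau κ i x ≡ 0ℤ

    -- Each improving exchange lowers the number of basis elements outside S, so the search stops.
    saturate : ∀ κ → Nonsingular κ → ∃ λ κ′ → Nonsingular κ′ × Saturated κ′
    saturate κ ns = go κ ns (ℕᵢ.<-wellFounded (weight κ))
      where
      go : ∀ κ → Nonsingular κ → Acc ℕ._<_ (weight κ) → ∃ λ κ′ → Nonsingular κ′ × Saturated κ′
      go κ ns (acc rec)
        with any? (λ i → any? λ x → ¬? (S? (κ i)) ×-dec S? x ×-dec ¬? (tableau κ i x ℤ.≟ 0ℤ))
      ... | yes (i , x , κi∉S , x∈S , t≢0) =
        go (exchange κ i x) (exchange-nonsingular κ i x t≢0) (rec (exchange-weight κ i x∈S κi∉S))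
      ... | no stuck = κ , ns , λ i x κi∉S x∈S →
        decidable-stable (tableau κ i x ℤ.≟ 0ℤ) λ t≢0 → stuck (i , x , κi∉S , x∈S , t≢0)

  module _ (frr : FullRowRank A) where

    -- Choose a basis saturated for the support of z. As z is nonzero, its support contains some x
    -- off this basis, and saturation keeps the fundamental circuit of x inside the support of z.
    circuit-in-support : ∀ {z x₀} → InKernel A z → z x₀ ≢ 0ℤ →
      ∃ λ Q → SignedCircuit A Q × (∀ y → Q y ≢ 0ℤ → z y ≢ 0ℤ) × ∃ λ y → Q y ≢ 0ℤ
    circuit-in-support {z} {x₀} z∈ker z≢0
      with saturate (nonzero? z) (proj₁ frr) (proj₂ frr)
    ... | κ , ns , saturated
      with any? (λ x → nonzero? z x ×-dec ¬? (inImage? κ x))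
    ... | no none = contradiction
      (kernel-offBasis ns z∈ker (λ x zx≢0 → decidable-stable (inImage? κ x) (λ x∉κ → none (x , zx≢0 , x∉κ))) x₀) z≢0
    ... | yes (x , zx≢0 , x∉κ) =
      Q , (fundamentalChain-simple ns x∉κ , fundamentalChain-kernel ns x , dependent , minimal) , inside , x , Qx≢0
      where
      Q = fundamentalChain κ x
      Qx≢0 : Q x ≢ 0ℤ
      Qx≢0 e = 0≢1 (trans (sym e) (fundamentalChain-self ns x∉κ))
      inside : ∀ y → Q y ≢ 0ℤ → z y ≢ 0ℤ
      inside y Qy≢0 with fundamentalChain-support ns x∉κ Qy≢0
      ... | inj₁ refl = zx≢0
      ... | inj₂ (j , refl , t≢0) = λ zy≡0 → t≢0 (saturated j x (λ zy≢0 → zy≢0 zy≡0) zx≢0)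
      dependent : ¬ Independent A (supp Q)
      dependent (B , (κ′ , _ , _ , B⊆κ′ , ns′) , Q⊆B) =
        Qx≢0 (kernel-offBasis ns′ (fundamentalChain-kernel ns x) (λ y Qy≢0 → B⊆κ′ y (Q⊆B (∈-supp⁺ Q Qy≢0))) x)
      minimal : ∀ D → D ⊂ supp Q → Independent A D
      minimal D (D⊆Q , y , y∈Q , y∉D) with fundamentalChain-support ns x∉κ (∈-supp⁻ Q y∈Q)
      ... | inj₁ refl = image κ , image-isBasis ns , λ {d} d∈D → ∈-comprehension⁺ (inImage? κ) (in-κ d∈D)
        where
        in-κ : ∀ {d} → d ∈ D → InImage κ d
        in-κ d∈D with fundamentalChain-support ns x∉κ (∈-supp⁻ Q (D⊆Q d∈D))
        ... | inj₁ refl = contradiction d∈D y∉D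
        ... | inj₂ (j , κj≡d , _) = j , κj≡d
      -- The removed element is `κ i`; since its tableau entry is nonzero, trading it for x gives a
      -- basis that contains the rest of the circuit.
      ... | inj₂ (i , refl , t≢0) =
        image (exchange κ i x) , image-isBasis (exchange-nonsingular κ i x t≢0) ,
        λ {d} d∈D → ∈-comprehension⁺ (inImage? (exchange κ i x)) (in-exchange d∈D)
        where
        in-exchange : ∀ {d} → d ∈ D → InImage (exchange κ i x) d
        in-exchange d∈D with fundamentalChain-support ns x∉κ (∈-supp⁻ Q (D⊆Q d∈D))
        ... | inj₁ refl = exchange-new κ i x
        ... | inj₂ (j , refl , _) = exchange-old κ x λ { refl → y∉D d∈D }

    -- Here the basis is saturated for the zero set of w. Some basis element `κ i` has w nonzero,
    -- and saturation makes row i of the tableau vanish wherever w does. For minimality, exchanging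
    -- `κ i` for y gives a basis that meets the support of this row in y alone.
    cocircuit-in-support : ∀ {w x₀} → InRowSpace A w → w x₀ ≢ 0ℤ →
      ∃ λ Q → SignedCocircuit A Q × (∀ y → Q y ≢ 0ℤ → w y ≢ 0ℤ) × ∃ λ y → Q y ≢ 0ℤ
    cocircuit-in-support {w} {x₀} w∈row w≢0
      with saturate (λ x → w x ℤ.≟ 0ℤ) (proj₁ frr) (proj₂ frr)
    ... | κ , ns , saturated
      with any? (λ i → nonzero? w (κ i))
    ... | no none = contradiction
      (rowSpace-onBasis ns w∈row (λ i → decidable-stable (w (κ i) ℤ.≟ 0ℤ) (λ wi≢0 → none (i , wi≢0))) x₀) w≢0
    ... | yes (i , wi≢0) =
      Q , (tableau-ternary κ i , tableau-rowSpace κ i , meets , minimal)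
        , (λ y Qy≢0 wy≡0 → Qy≢0 (saturated i y wi≢0 wy≡0)) , κ i , Qi≢0
      where
      Q = tableau κ i
      Qi≢0 : Q (κ i) ≢ 0ℤ
      Qi≢0 e = 0≢1 (trans (sym e) (tableau-diagonal ns i))
      meets : ∀ B → IsBasis A B → Meets (supp Q) B
      meets B (κ′ , _ , κ′⊆B , _ , ns′) with any? (λ j → nonzero? Q (κ′ j))
      ... | yes (j , Qj≢0) = κ′ j , ∈-supp⁺ Q Qj≢0 , κ′⊆B j
      ... | no none = contradiction (rowSpace-onBasis {w = Q} ns′ (tableau-rowSpace κ i)
        (λ j → decidable-stable (Q (κ′ j) ℤ.≟ 0ℤ) (λ Qj≢0 → none (j , Qj≢0))) (κ i)) Qi≢0
      minimal : ∀ D → D ⊂ supp Q → ∃ λ B → IsBasis A B × ¬ Meets D B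
      minimal D (D⊆Q , y , y∈Q , y∉D) =
        image (exchange κ i y) , image-isBasis (exchange-nonsingular κ i y (∈-supp⁻ Q y∈Q)) , misses
        where
        misses : ¬ Meets D (image (exchange κ i y))
        misses (d , d∈D , d∈B) with exchange-image κ (∈-comprehension⁻ (inImage? (exchange κ i y)) d∈B)
        ... | inj₁ refl = y∉D d∈D
        ... | inj₂ (j , i≢j , refl) = ∈-supp⁻ Q (D⊆Q d∈D) (tableau-offDiagonal κ i≢j)

-- Subtracting multiples of a simple chain, coordinate by coordinate

argmin : ∀ {n} {S : Fin n → Set} → Decidable S → (f : Fin n → ℕ) → ∀ {x} → S x →
         ∃ λ y → S y × ∀ z → S z → f y ℕ.≤ f z
argmin {S = S} S? f {x} s = go s (ℕᵢ.<-wellFounded (f x))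
  where
  go : ∀ {x} → S x → Acc ℕ._<_ (f x) → ∃ λ y → S y × ∀ z → S z → f y ℕ.≤ f z
  go {x} s (acc rec) with any? (λ z → S? z ×-dec f z ℕ.<? f x)
  ... | yes (z , sz , fz<fx) = go sz (rec fz<fx)
  ... | no none = x , s , λ z sz → ℕₚ.≮⇒≥ (λ fz<fx → none (z , sz , fz<fx))

-- `sign` of zero is `+`, so a positive q agrees with z = 0. Uses of this relation therefore also
-- carry a proof that z is nonzero wherever q is.
Agree : ℤ → ℤ → Set
Agree q z = q ≢ 0ℤ × sign q ≡ sign z

agree? : ∀ q z → Dec (Agree q z)
agree? q z = ¬? (q ℤ.≟ 0ℤ) ×-dec sign q Signₚ.≟ sign z

-- The form `sign z ◃ _` exhibits that the result is zero or keeps the sign of z, which is all that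
-- conformality asks; the bound on m prevents overshooting zero.
subtract-agreeing : ∀ {q z} m → IsTernary q → Agree q z → m ℕ.≤ ∣ z ∣ →
  z + (- ℤ.+ m) * q ≡ sign z ◃ (∣ z ∣ ℕ.∸ m)
subtract-agreeing {z = ℤ.+ a} m (inj₁ refl) _ m≤a = begin
  ℤ.+ a + (- ℤ.+ m) * 1ℤ  ≡⟨ cong (ℤ.+ a +_) (ℤₚ.*-identityʳ (- ℤ.+ m)) ⟩
  ℤ.+ a + - ℤ.+ m         ≡⟨ ℤₚ.m-n≡m⊖n a m ⟩
  a ⊖ m                   ≡⟨ ℤₚ.⊖-≥ m≤a ⟩
  ℤ.+ (a ℕ.∸ m)           ≡⟨ ℤₚ.+◃n≡+n _ ⟨
  Sign.+ ◃ (a ℕ.∸ m)      ∎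
subtract-agreeing {z = ℤ.-[1+ a ]} m (inj₂ (inj₂ refl)) _ m≤1+a = begin
  -[1+ a ] + (- ℤ.+ m) * -[1+ 0 ]  ≡⟨ cong (-[1+ a ] +_) (cancel (ℤ.+ m)) ⟩
  m ⊖ suc a                        ≡⟨ ℤₚ.⊖-≤ m≤1+a ⟩
  - ℤ.+ (suc a ℕ.∸ m)              ≡⟨ ℤₚ.-◃n≡-n _ ⟨
  Sign.- ◃ (suc a ℕ.∸ m)           ∎
  where
  cancel : ∀ a → - a * - 1ℤ ≡ a
  cancel = solve-∀
subtract-agreeing m (inj₂ (inj₁ refl)) (0≢0 , _) _ = contradiction refl 0≢0
subtract-agreeing {z = -[1+ a ]} m (inj₁ refl) (_ , ()) _
subtract-agreeing {z = ℤ.+ a} m (inj₂ (inj₂ refl)) (_ , ()) _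

subtract-disagreeing : ∀ {q z} m → IsTernary q → q ≢ 0ℤ → sign q ≢ sign z →
  z + (- ℤ.+ m) * q ≡ sign z ◃ (∣ z ∣ ℕ.+ m)
subtract-disagreeing {z = ℤ.+ a} m (inj₂ (inj₂ refl)) _ _ = begin
  ℤ.+ a + (- ℤ.+ m) * -[1+ 0 ]  ≡⟨ cong (ℤ.+ a +_) (cancel (ℤ.+ m)) ⟩
  ℤ.+ (a ℕ.+ m)                 ≡⟨ ℤₚ.+◃n≡+n _ ⟨
  Sign.+ ◃ (a ℕ.+ m)            ∎
  where
  cancel : ∀ a → - a * - 1ℤ ≡ a
  cancel = solve-∀
subtract-disagreeing {z = -[1+ a ]} m (inj₁ refl) _ _ = begin
  - ℤ.+ suc a + (- ℤ.+ m) * 1ℤ  ≡⟨ collect (ℤ.+ suc a) (ℤ.+ m) ⟩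
  - ℤ.+ (suc a ℕ.+ m)           ≡⟨ ℤₚ.-◃n≡-n _ ⟨
  Sign.- ◃ (suc a ℕ.+ m)        ∎
  where
  collect : ∀ a b → - a + - b * 1ℤ ≡ - (a + b)
  collect = solve-∀
subtract-disagreeing m (inj₂ (inj₁ refl)) 0≢0 _ = contradiction refl 0≢0
subtract-disagreeing {z = -[1+ a ]} m (inj₂ (inj₂ refl)) _ s≢ = contradiction refl s≢
subtract-disagreeing {z = ℤ.+ a} m (inj₁ refl) _ s≢ = contradiction refl s≢

◃-sign : ∀ {z} s k → z ≡ s ◃ k → z ≢ 0ℤ → sign z ≡ s
◃-sign s zero    refl z≢0 = contradiction refl z≢0
◃-sign s (suc k) refl _   = ℤₚ.sign-◃ s (suc k)

sign-neg : ∀ {q} → q ≢ 0ℤ → sign (- q) ≡ opposite (sign q)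
sign-neg {ℤ.+ zero}  q≢0 = contradiction refl q≢0
sign-neg {ℤ.+ suc _} _   = refl
sign-neg { -[1+ _ ]} _   = refl

neg≢0 : ∀ {q} → q ≢ 0ℤ → - q ≢ 0ℤ
neg≢0 q≢0 = q≢0 ∘ neg≡0⇒≡0

-- Conformal decomposition

_⊑_ : ∀ {n} → Chain n → Chain n → Set
C ⊑ z = ∀ y → C y ≢ 0ℤ → z y ≢ 0ℤ × sign (C y) ≡ sign (z y)

⊑-trans : ∀ {n} {P Q R : Chain n} → P ⊑ Q → Q ⊑ R → P ⊑ R
⊑-trans P⊑Q Q⊑R y Py≢0 with Qy≢0 , e ← P⊑Q y Py≢0 with Ry≢0 , e′ ← Q⊑R y Qy≢0 = Ry≢0 , trans e e′

∼-⊑ : ∀ {n} {P Q : Chain n} {O} → P ⊑ Q → Q ∼ O → P ∼ O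
∼-⊑ P⊑Q Q∼O y Py≢0 with Qy≢0 , e ← P⊑Q y Py≢0 = trans e (Q∼O y Qy≢0)

supp-neg : ∀ {n} (P : Chain n) → supp (negChain P) ≡ supp P
supp-neg P = tabulate-cong (λ x → pointwise (P x))
  where
  pointwise : ∀ z → not (does (- z ℤ.≟ 0ℤ)) ≡ not (does (z ℤ.≟ 0ℤ))
  pointwise (ℤ.+ zero)  = refl
  pointwise (ℤ.+ suc _) = refl
  pointwise -[1+ _ ]    = refl

other : Kind → Kind
other circuit   = cocircuit
other cocircuit = circuit

InSpace : ∀ {r n} → Mat r n → Kind → Chain n → Set
InSpace A circuit   = InKernel A
InSpace A cocircuit = InRowSpace A

module _ {r n} (A : Mat r n) where

  inSpace-+ : ∀ k {P Q} → InSpace A k P → InSpace A k Q → InSpace A k (λ x → P x + Q x)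
  inSpace-+ circuit   = inKernel-+ A
  inSpace-+ cocircuit {P} {Q} = inRowSpace-+ A {P} {Q}

  inSpace-scale : ∀ k c {P} → InSpace A k P → InSpace A k (λ x → c * P x)
  inSpace-scale circuit   = inKernel-scale A
  inSpace-scale cocircuit = inRowSpace-scale A

  inSpace-cong : ∀ k {P Q} → P ≗ Q → InSpace A k P → InSpace A k Q
  inSpace-cong circuit   P≗Q P∈ i = trans (sumℤ-cong n (λ x → cong (A i x *_) (sym (P≗Q x)))) (P∈ i)
  inSpace-cong cocircuit P≗Q (y , e) = y , λ x → trans (e x) (cong toℚ (P≗Q x))

  inSpace-neg : ∀ k {P} → InSpace A k P → InSpace A k (negChain P)
  inSpace-neg k {P} P∈ = inSpace-cong k (λ x → ℤₚ.-1*i≡-i (P x)) (inSpace-scale k -[1+ 0 ] P∈)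

  inSpace-zero : ∀ k → InSpace A k (λ _ → 0ℤ)
  inSpace-zero circuit   i = sumℤ-zero n (λ x → ℤₚ.*-zeroʳ (A i x))
  inSpace-zero cocircuit = inRowSpace-combination A (λ _ → 0ℤ) (λ x → sumℤ-zero r (λ i → ℤₚ.*-zeroˡ (A i x)))

  orthogonal : ∀ k {P Q} → InSpace A k P → InSpace A (other k) Q → sumℤ n (λ x → P x * Q x) ≡ 0ℤ
  orthogonal circuit   P∈ Q∈ = kernel⊥rowSpace A P∈ Q∈
  orthogonal cocircuit {P} {Q} P∈ Q∈ =
    trans (sumℤ-cong n (λ x → ℤₚ.*-comm (P x) (Q x))) (kernel⊥rowSpace A Q∈ P∈)

  signed-inSpace : ∀ k {P} → SignedOf A k P → InSpace A k P
  signed-inSpace circuit   (_ , P∈ , _) = P∈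
  signed-inSpace cocircuit (_ , P∈ , _) = P∈

  signed-simple : ∀ k {P} → SignedOf A k P → Simple P
  signed-simple circuit   (s , _) = s
  signed-simple cocircuit (s , _) = s

  signed-neg : ∀ k {P} → SignedOf A k P → SignedOf A k (negChain P)
  signed-neg circuit {P} (s , P∈ , c) =
    (λ x → ternary-neg (s x)) , inSpace-neg circuit P∈ , subst (IsCircuit A) (sym (supp-neg P)) c
  signed-neg cocircuit {P} (s , P∈ , c) =
    (λ x → ternary-neg (s x)) , inSpace-neg cocircuit {P} P∈ , subst (IsCocircuit A) (sym (supp-neg P)) c

  -- Subtracting the largest multiple of Q that does not reverse a sign of z.
  eliminate : ∀ k {Q z} → SignedOf A k Q → InSpace A k z → (∀ y → Q y ≢ 0ℤ → z y ≢ 0ℤ) →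
    ∀ {y} → Agree (Q y) (z y) → ∃ λ z′ → InSpace A k z′ × z′ ⊑ z
      × (∀ x → z x ≢ 0ℤ → ¬ Agree (Q x) (z x) → z′ x ≢ 0ℤ)
      × ∃ λ y → z y ≢ 0ℤ × z′ y ≡ 0ℤ
  eliminate k {Q} {z} Q∈ z∈ Q⊆z agrees
    with argmin (λ y → agree? (Q y) (z y)) (λ y → ∣ z y ∣) agrees
  ... | y , agree-y , least =
    z′ , inSpace-+ k z∈ (inSpace-scale k (- ℤ.+ m) (signed-inSpace k Q∈)) , conformal , kept
       , y , Q⊆z y (proj₁ agree-y)
       , trans (subtract-agreeing m (Q-simple y) agree-y ℕₚ.≤-refl) (cong (sign (z y) ◃_) (ℕₚ.n∸n≡0 m))
    where
    m = ∣ z y ∣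
    z′ : Chain n
    z′ x = z x + (- ℤ.+ m) * Q x
    Q-simple = signed-simple k Q∈
    unchanged : ∀ x → Q x ≡ 0ℤ → z′ x ≡ z x
    unchanged x Qx≡0 = trans (cong (λ t → z x + (- ℤ.+ m) * t) Qx≡0)
      (trans (cong (z x +_) (ℤₚ.*-zeroʳ (- ℤ.+ m))) (ℤₚ.+-identityʳ (z x)))
    kept : ∀ x → z x ≢ 0ℤ → ¬ Agree (Q x) (z x) → z′ x ≢ 0ℤ
    kept x zx≢0 disagree z′x≡0 with Q x ℤ.≟ 0ℤ
    ... | yes Qx≡0 = zx≢0 (trans (sym (unchanged x Qx≡0)) z′x≡0)
    ... | no  Qx≢0 = zx≢0 (ℤₚ.∣i∣≡0⇒i≡0 (ℕₚ.m+n≡0⇒m≡0 ∣ z x ∣ (begin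
      ∣ z x ∣ ℕ.+ m                       ≡⟨ ℤₚ.abs-◃ (sign (z x)) _ ⟨
      ∣ sign (z x) ◃ (∣ z x ∣ ℕ.+ m) ∣    ≡⟨ cong ∣_∣ (subtract-disagreeing m (Q-simple x) Qx≢0 (λ e → disagree (Qx≢0 , e))) ⟨
      ∣ z′ x ∣                            ≡⟨ cong ∣_∣ z′x≡0 ⟩
      0                                   ∎)))
    conformal : z′ ⊑ z
    conformal x z′x≢0 with Q x ℤ.≟ 0ℤ
    ... | yes Qx≡0 = (λ zx≡0 → z′x≢0 (trans (unchanged x Qx≡0) zx≡0)) , cong sign (unchanged x Qx≡0)
    ... | no  Qx≢0 with agree? (Q x) (z x)
    ...   | yes agree = Q⊆z x Qx≢0 , ◃-sign (sign (z x)) _ (subtract-agreeing m (Q-simple x) agree (least x agree)) z′x≢0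
    ...   | no disagree = Q⊆z x Qx≢0 ,
      ◃-sign (sign (z x)) _ (subtract-disagreeing m (Q-simple x) Qx≢0 (λ e → disagree (Qx≢0 , e))) z′x≢0

  module _ (tu : TotallyUnimodular A) (frr : FullRowRank A) where

    signed-in-support : ∀ k {z x} → InSpace A k z → z x ≢ 0ℤ →
      ∃ λ Q → SignedOf A k Q × (∀ y → Q y ≢ 0ℤ → z y ≢ 0ℤ) × ∃ λ y → Q y ≢ 0ℤ
    signed-in-support circuit   = UnimodularTableau.circuit-in-support A tu frr
    signed-in-support cocircuit = UnimodularTableau.cocircuit-in-support A tu frr

    -- Take a signed (co)circuit Q inside the support of z. If Q or - Q agrees with z somewhere but
    -- not at x, subtracting a multiple of it shrinks the support and keeps x, so induction applies.
    -- If neither does, then Q or - Q itself conforms to z and passes through x.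
    conformal-signed : ∀ k {z x} → InSpace A k z → z x ≢ 0ℤ →
      ∃ λ C → SignedOf A k C × C ⊑ z × C x ≢ 0ℤ
    conformal-signed k {z} z∈ zx≢0 = go z∈ zx≢0 (ℕᵢ.<-wellFounded Subset.∣ supp z ∣)
      where
      go : ∀ {z x} → InSpace A k z → z x ≢ 0ℤ → Acc ℕ._<_ Subset.∣ supp z ∣ →
           ∃ λ C → SignedOf A k C × C ⊑ z × C x ≢ 0ℤ
      go {z} {x} z∈ zx≢0 (acc rec) with signed-in-support k z∈ zx≢0
      ... | Q , Q∈ , Q⊆z , y , Qy≢0 = choose
        where
        reduce : ∀ {Q} → SignedOf A k Q → (∀ y → Q y ≢ 0ℤ → z y ≢ 0ℤ) →
          ∀ {y} → Agree (Q y) (z y) → ¬ Agree (Q x) (z x) → ∃ λ C → SignedOf A k C × C ⊑ z × C x ≢ 0ℤ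
        reduce Q∈ Q⊆z agree-y disagree-x
          with z′ , z′∈ , z′⊑z , kept , w , zw≢0 , z′w≡0 ← eliminate k Q∈ z∈ Q⊆z agree-y
          with C , C∈ , C⊑z′ , Cx≢0 ← go z′∈ (kept x zx≢0 disagree-x) (rec (p⊂q⇒∣p∣<∣q∣
            ((λ {u} u∈ → ∈-supp⁺ z (proj₁ (z′⊑z u (∈-supp⁻ z′ u∈)))) ,
             w , ∈-supp⁺ z zw≢0 , λ w∈ → ∈-supp⁻ z′ w∈ z′w≡0)))
          = C , C∈ , ⊑-trans C⊑z′ z′⊑z , Cx≢0
        -Q∈ = signed-neg k Q∈
        -Q⊆z : ∀ y → - Q y ≢ 0ℤ → z y ≢ 0ℤ
        -Q⊆z y -Qy≢0 = Q⊆z y (-Qy≢0 ∘ cong -_)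
        neg-agrees : ∀ {y} → Q y ≢ 0ℤ → ¬ Agree (Q y) (z y) → Agree (- Q y) (z y)
        neg-agrees {y} Qy≢0 disagree = neg≢0 Qy≢0 , trans (sign-neg Qy≢0) (opposite-≢ (λ e → disagree (Qy≢0 , e)))
          where
          opposite-≢ : ∀ {s t} → s ≢ t → opposite s ≡ t
          opposite-≢ {Sign.+} {Sign.+} s≢t = contradiction refl s≢t
          opposite-≢ {Sign.+} {Sign.-} _   = refl
          opposite-≢ {Sign.-} {Sign.+} _   = refl
          opposite-≢ {Sign.-} {Sign.-} s≢t = contradiction refl s≢t
        neg-disagrees : ∀ {y} → Agree (Q y) (z y) → ¬ Agree (- Q y) (z y)
        neg-disagrees (Qy≢0 , e) (_ , e′) =
          Signₚ.s≢opposite[s] _ (trans e (trans (sym e′) (sign-neg Qy≢0)))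
        choose : ∃ λ C → SignedOf A k C × C ⊑ z × C x ≢ 0ℤ
        choose with agree? (Q x) (z x)
        ... | yes agree-x with any? (λ y → nonzero? Q y ×-dec ¬? (agree? (Q y) (z y)))
        ...   | yes (y , Qy≢0 , disagree-y) = reduce -Q∈ -Q⊆z {y} (neg-agrees Qy≢0 disagree-y) (neg-disagrees agree-x)
        ...   | no none = Q , Q∈ , (λ y Qy≢0 → Q⊆z y Qy≢0 ,
                  proj₂ (decidable-stable (agree? (Q y) (z y)) (λ ¬a → none (y , Qy≢0 , ¬a)))) , proj₁ agree-x
        choose | no disagree-x with any? (λ y → agree? (Q y) (z y))
        ...   | yes (y , agree-y) = reduce Q∈ Q⊆z agree-y disagree-x
        ...   | no none with Q x ℤ.≟ 0ℤ
        -- Q agrees with z nowhere, so - Q conforms to z but misses x; it serves only to shrink the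
        -- support.
        ...     | yes Qx≡0 = reduce -Q∈ -Q⊆z {y} (neg-agrees Qy≢0 (λ a → none (y , a))) (λ (-Qx≢0 , _) → -Qx≢0 (cong -_ Qx≡0))
        ...     | no  Qx≢0 = negChain Q , -Q∈ , (λ y -Qy≢0 → -Q⊆z y -Qy≢0 ,
                    proj₂ (neg-agrees (-Qy≢0 ∘ cong -_) (λ a → none (y , a)))) , neg≢0 Qx≢0

    -- A conforming piece C through f uses up the whole coefficient at f. The remainder z - C still
    -- conforms to z, so each of its pieces would have to pass through f, where the remainder is
    -- zero; hence it has no pieces.
    conformal-through : ∀ k {z f} → InSpace A k z → ∣ z f ∣ ℕ.≤ 1 →
      (∀ {C x} → SignedOf A k C → C ⊑ z → C x ≢ 0ℤ → C f ≢ 0ℤ) →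
      z ≗ (λ _ → 0ℤ) ⊎ ∃ λ C → SignedOf A k C × z ≗ C × C f ≢ 0ℤ
    conformal-through k {z} {f} z∈ ∣zf∣≤1 through with z f ℤ.≟ 0ℤ
    ... | yes zf≡0 = inj₁ λ x → decidable-stable (z x ℤ.≟ 0ℤ) λ zx≢0 →
      let C , C∈ , C⊑z , Cx≢0 = conformal-signed k z∈ zx≢0 in proj₁ (C⊑z f (through C∈ C⊑z Cx≢0)) zf≡0
    ... | no zf≢0 with C , C∈ , C⊑z , Cf≢0 ← conformal-signed k z∈ zf≢0 =
      inj₂ (C , C∈ , (λ x → decidable-stable (z x ℤ.≟ C x) λ zx≢Cx →
        let D , D∈ , D⊑z′ , Dx≢0 = conformal-signed k z′∈ (λ z′x≡0 → zx≢Cx (trans (split x) (trans (cong (_+ C x) z′x≡0) (ℤₚ.+-identityˡ (C x)))))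
        in proj₁ (D⊑z′ f (through D∈ (⊑-trans D⊑z′ z′⊑z) Dx≢0)) z′f≡0) , Cf≢0)
      where
      z′ : Chain n
      z′ x = z x + (- 1ℤ) * C x
      z′∈ = inSpace-+ k z∈ (inSpace-scale k (- 1ℤ) (signed-inSpace k C∈))
      split : ∀ x → z x ≡ z′ x + C x
      split x = identity (z x) (C x)
        where
        identity : ∀ a b → a ≡ a + (- 1ℤ) * b + b
        identity = solve-∀
      positive : ∀ x → z x ≢ 0ℤ → 1 ℕ.≤ ∣ z x ∣
      positive x zx≢0 = ℕₚ.n≢0⇒n>0 (zx≢0 ∘ ℤₚ.∣i∣≡0⇒i≡0)
      step : ∀ x → C x ≢ 0ℤ → z′ x ≡ sign (z x) ◃ (∣ z x ∣ ℕ.∸ 1)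
      step x Cx≢0 with zx≢0 , e ← C⊑z x Cx≢0 =
        subtract-agreeing 1 (signed-simple k C∈ x) (Cx≢0 , e) (positive x zx≢0)
      z′f≡0 : z′ f ≡ 0ℤ
      z′f≡0 = trans (step f Cf≢0) (cong (sign (z f) ◃_) (ℕₚ.m≤n⇒m∸n≡0 ∣zf∣≤1))
      z′⊑z : z′ ⊑ z
      z′⊑z x z′x≢0 with C x ℤ.≟ 0ℤ
      ... | no Cx≢0 = proj₁ (C⊑z x Cx≢0) , ◃-sign (sign (z x)) _ (step x Cx≢0) z′x≢0
      ... | yes Cx≡0 = (λ zx≡0 → z′x≢0 (trans same zx≡0)) , cong sign same
        where
        same : z′ x ≡ z x
        same = trans (cong (λ t → z x + (- 1ℤ) * t) Cx≡0) (ℤₚ.+-identityʳ (z x))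

-- Signed chains

unit≢0 : ∀ s → s ◃ 1 ≢ 0ℤ
unit≢0 Sign.+ ()
unit≢0 Sign.- ()

-unit : ∀ s → - (s ◃ 1) ≡ opposite s ◃ 1
-unit Sign.+ = refl
-unit Sign.- = refl

unit*unit : ∀ s → (s ◃ 1) * (s ◃ 1) ≡ 1ℤ
unit*unit Sign.+ = refl
unit*unit Sign.- = refl

unit*-unit : ∀ s → (s ◃ 1) * (opposite s ◃ 1) ≡ -[1+ 0 ]
unit*-unit Sign.+ = refl
unit*-unit Sign.- = refl

simple-unit : ∀ {z} s → IsTernary z → z ≢ 0ℤ → sign z ≡ s → z ≡ s ◃ 1
simple-unit s (inj₁ refl)        _   refl = refl
simple-unit s (inj₂ (inj₁ refl)) 0≢0 _    = contradiction refl 0≢0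
simple-unit s (inj₂ (inj₂ refl)) _   refl = refl

sumℤ-+ℕ : ∀ k (h : Fin k → ℕ) → sumℤ k (λ i → ℤ.+ h i) ≡ ℤ.+ ℕ-Sum.sum h
sumℤ-+ℕ zero    h = refl
sumℤ-+ℕ (suc k) h = cong (ℤ.+ h zero +_) (sumℤ-+ℕ k (h ∘ suc))

ℕ-sum≡0 : ∀ {k} (h : Fin k → ℕ) → ℕ-Sum.sum h ≡ 0 → ∀ i → h i ≡ 0
ℕ-sum≡0 h e zero    = ℕₚ.m+n≡0⇒m≡0 (h zero) e
ℕ-sum≡0 h e (suc i) = ℕ-sum≡0 (h ∘ suc) (ℕₚ.m+n≡0⇒n≡0 (h zero) e) i

sameSign-product : ∀ p q → (p ≢ 0ℤ → q ≢ 0ℤ → sign p ≡ sign q) → p * q ≡ ℤ.+ (∣ p ∣ ℕ.* ∣ q ∣)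
sameSign-product (ℤ.+ zero)  q           _ = refl
sameSign-product p@(ℤ.+ suc _) (ℤ.+ zero)  _ = trans (ℤₚ.*-zeroʳ p) (cong ℤ.+_ (sym (ℕₚ.*-zeroʳ ∣ p ∣)))
sameSign-product p@(-[1+ _ ]) (ℤ.+ zero)  _ = trans (ℤₚ.*-zeroʳ p) (cong ℤ.+_ (sym (ℕₚ.*-zeroʳ ∣ p ∣)))
sameSign-product (ℤ.+ suc _) (ℤ.+ suc _) _ = refl
sameSign-product -[1+ _ ]    -[1+ _ ]    _ = refl
sameSign-product (ℤ.+ suc _) -[1+ _ ]    e = contradiction (e (λ ()) (λ ())) λ ()
sameSign-product -[1+ _ ]    (ℤ.+ suc _) e = contradiction (e (λ ()) (λ ())) λ ()

module _ {r n} (A : Mat r n) where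

  -- Equal signs make every term of the pairing nonnegative, and orthogonality makes the terms sum
  -- to zero.
  sameSign⇒disjoint : ∀ k {P Q} → InSpace A k P → InSpace A (other k) Q →
    (∀ x → P x ≢ 0ℤ → Q x ≢ 0ℤ → sign (P x) ≡ sign (Q x)) → ∀ x → P x ≢ 0ℤ → Q x ≡ 0ℤ
  sameSign⇒disjoint k {P} {Q} P∈ Q∈ same x Px≢0
    with ℕₚ.m*n≡0⇒m≡0∨n≡0 ∣ P x ∣ (ℕ-sum≡0 (λ x → ∣ P x ∣ ℕ.* ∣ Q x ∣) (ℤₚ.+-injective (begin
      ℤ.+ ℕ-Sum.sum (λ x → ∣ P x ∣ ℕ.* ∣ Q x ∣)    ≡⟨ sumℤ-+ℕ n (λ x → ∣ P x ∣ ℕ.* ∣ Q x ∣) ⟨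
      sumℤ n (λ x → ℤ.+ (∣ P x ∣ ℕ.* ∣ Q x ∣))     ≡⟨ sumℤ-cong n (λ x → sameSign-product (P x) (Q x) (same x)) ⟨
      sumℤ n (λ x → P x * Q x)                     ≡⟨ orthogonal A k P∈ Q∈ ⟩
      0ℤ                                           ∎)) x)
  ... | inj₁ ∣Px∣≡0 = contradiction (ℤₚ.∣i∣≡0⇒i≡0 ∣Px∣≡0) Px≢0
  ... | inj₂ ∣Qx∣≡0 = ℤₚ.∣i∣≡0⇒i≡0 ∣Qx∣≡0

cancelling-term : ∀ {n} (g : Fin n → ℤ) f → g f ≡ 1ℤ → (∀ x → x ≢ f → g x ≡ 0ℤ ⊎ g x ≡ -[1+ 0 ]) →
  sumℤ n g ≡ 0ℤ → ∃ λ e → e ≢ f × g e ≢ 0ℤ × (∀ x → g x ≢ 0ℤ → x ≡ f ⊎ x ≡ e)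
cancelling-term {n} g f gf≡1 rest Σ≡0 with any? (λ x → ¬? (x ≟ f) ×-dec nonzero? g x)
... | no none = contradiction (trans (sym Σ≡0) (trans
      (sumℤ-single n f (λ x x≢f → decidable-stable (g x ℤ.≟ 0ℤ) (λ gx≢0 → none (x , x≢f , gx≢0)))) gf≡1)) 0≢1
... | yes (e , e≢f , ge≢0) = e , e≢f , ge≢0 , λ x gx≢0 → decide x gx≢0 (x ≟ f) (x ≟ e)
  where
  ge≡-1 : g e ≡ -[1+ 0 ]
  ge≡-1 with rest e e≢f
  ... | inj₁ ge≡0  = contradiction ge≡0 ge≢0
  ... | inj₂ ge≡-1 = ge≡-1
  h : Fin n → ℤ
  -- h vanishes at f and e and is 0 or 1 elsewhere, while its sum is zero. So h is zero everywhere,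
  -- which leaves no third nonzero value of g.
  h x = - g x + (δ f x + - δ e x)
  δ-sum : ∀ a → sumℤ n (δ a) ≡ 1ℤ
  δ-sum a = trans (sumℤ-cong n (λ x → sym (ℤₚ.*-identityˡ (δ a x)))) (sumℤ-δ (λ _ → 1ℤ) a)
  Σh≡0 : sumℤ n h ≡ 0ℤ
  Σh≡0 = begin
    sumℤ n h                                                  ≡⟨ sumℤ-+ n (λ x → - g x) (λ x → δ f x + - δ e x) ⟩
    sumℤ n (λ x → - g x) + sumℤ n (λ x → δ f x + - δ e x)     ≡⟨ cong₂ _+_ (trans (sumℤ-neg n g) (cong -_ Σ≡0))
        (trans (sumℤ-+ n (δ f) (λ x → - δ e x)) (cong₂ _+_ (δ-sum f) (trans (sumℤ-neg n (δ e)) (cong -_ (δ-sum e))))) ⟩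
    0ℤ                                                        ∎
  h-elsewhere : ∀ {x} → x ≢ f → x ≢ e → h x ≡ - g x
  h-elsewhere {x} x≢f x≢e = trans
    (cong₂ (λ s t → - g x + (s + - t)) (δ-≢ (x≢f ∘ sym)) (δ-≢ (x≢e ∘ sym))) (ℤₚ.+-identityʳ (- g x))
  h-nonneg : ∀ x → Dec (x ≡ f) → Dec (x ≡ e) → h x ≡ ℤ.+ ∣ h x ∣
  h-nonneg x (yes refl) _ = trans h≡0 (cong (λ z → ℤ.+ ∣ z ∣) (sym h≡0))
    where
    h≡0 : h x ≡ 0ℤ
    h≡0 = cong₂ _+_ (cong -_ gf≡1) (cong₂ (λ s t → s + - t) (δ-refl x) (δ-≢ e≢f))
  h-nonneg x (no x≢f) (yes refl) = trans h≡0 (cong (λ z → ℤ.+ ∣ z ∣) (sym h≡0))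
    where
    h≡0 : h x ≡ 0ℤ
    h≡0 = cong₂ _+_ (cong -_ ge≡-1) (cong₂ (λ s t → s + - t) (δ-≢ (x≢f ∘ sym)) (δ-refl x))
  h-nonneg x (no x≢f) (no x≢e) with rest x x≢f
  ... | inj₁ gx≡0 = trans hx (cong (λ z → ℤ.+ ∣ z ∣) (sym hx))
    where
    hx : h x ≡ 0ℤ
    hx = trans (h-elsewhere x≢f x≢e) (cong -_ gx≡0)
  ... | inj₂ gx≡-1 = trans hx (cong (λ z → ℤ.+ ∣ z ∣) (sym hx))
    where
    hx : h x ≡ 1ℤ
    hx = trans (h-elsewhere x≢f x≢e) (cong -_ gx≡-1)
  h≡0 : ∀ x → h x ≡ 0ℤ
  h≡0 x = ℤₚ.∣i∣≡0⇒i≡0 (ℕ-sum≡0 (λ x → ∣ h x ∣) (ℤₚ.+-injective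
    (trans (sym (sumℤ-+ℕ n (λ x → ∣ h x ∣)))
      (trans (sumℤ-cong n (λ x → sym (h-nonneg x (x ≟ f) (x ≟ e)))) Σh≡0))) x)
  decide : ∀ x → g x ≢ 0ℤ → Dec (x ≡ f) → Dec (x ≡ e) → x ≡ f ⊎ x ≡ e
  decide x gx≢0 (yes x≡f) _         = inj₁ x≡f
  decide x gx≢0 (no _)    (yes x≡e) = inj₂ x≡e
  decide x gx≢0 (no x≢f)  (no x≢e)  =
    contradiction (neg≡0⇒≡0 (trans (sym (h-elsewhere x≢f x≢e)) (h≡0 x))) gx≢0

-- Reorientations

rev-∈ : ∀ {n} {S : Subset n} (O : Orientation n) {x} → x ∈ S → rev S O x ≡ opposite (O x)
rev-∈ O {x} x∈S = cong (if_then opposite (O x) else O x) ([]=⇒lookup x∈S)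

rev-∉ : ∀ {n} {S : Subset n} (O : Orientation n) {x} → x ∉ S → rev S O x ≡ O x
rev-∉ {S = S} O {x} x∉S with lookup S x in e
... | true  = contradiction (lookup⇒[]= x S e) x∉S
... | false = refl

rev-supp : ∀ {n} (P : Chain n) (O : Orientation n) {x} → P x ≢ 0ℤ → rev (supp P) O x ≡ opposite (O x)
rev-supp P O Px≢0 = rev-∈ O (∈-supp⁺ P Px≢0)

rev-nonsupp : ∀ {n} (P : Chain n) (O : Orientation n) {x} → P x ≡ 0ℤ → rev (supp P) O x ≡ O x
rev-nonsupp P O Px≡0 = rev-∉ O (λ x∈ → ∈-supp⁻ P x∈ Px≡0)

x∈p─q⇒x∉q : ∀ {n} (p q : Subset n) {x} → x ∈ p ─ q → x ∉ q
x∈p─q⇒x∉q (_ ∷ p) (false ∷ q) (there x∈) (there x∈q) = x∈p─q⇒x∉q p q x∈ x∈q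
x∈p─q⇒x∉q (_ ∷ p) (true  ∷ q) (there x∈) (there x∈q) = x∈p─q⇒x∉q p q x∈ x∈q

data KindView (k : Kind) : Kind → Set where
  same      : KindView k k
  different : KindView k (other k)

kindView : ∀ k k′ → KindView k k′
kindView circuit   circuit   = same
kindView circuit   cocircuit = different
kindView cocircuit circuit   = different
kindView cocircuit cocircuit = same

both-kinds : ∀ {P : Kind → Set} k → P k → P (other k) → ∀ k′ → P k′
both-kinds k p q k′ with kindView k k′
... | same      = p
... | different = q

other-involutive : ∀ k → other (other k) ≡ k
other-involutive circuit   = refl
other-involutive cocircuit = refl

other≢ : ∀ {k} → k ≢ other k
other≢ {circuit}   ()
other≢ {cocircuit} ()

-- The kernel and row-space parts u of a reversal, seen at a single element.
data Flip (s s′ : Sign) (u : Kind → ℤ) : Set where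
  keep : (∀ k → u k ≡ 0ℤ) → s′ ≡ s → Flip s s′ u
  flip : ∀ k → u k ≡ s ◃ 1 → u (other k) ≡ 0ℤ → s′ ≡ opposite s → Flip s s′ u

flip-nonzero : ∀ {s s′ u} k → Flip s s′ u → u k ≢ 0ℤ → u k ≡ s ◃ 1 × u (other k) ≡ 0ℤ × s′ ≡ opposite s
flip-nonzero k (keep u≡0 _) uk≢0 = contradiction (u≡0 k) uk≢0
flip-nonzero k (flip k′ e₁ e₂ e₃) uk≢0 with kindView k′ k
... | same      = e₁ , e₂ , e₃
... | different = contradiction e₂ uk≢0

flip-zero : ∀ {s s′ u} k → Flip s s′ u → u k ≡ 0ℤ → u (other k) ≡ 0ℤ → s′ ≡ s
flip-zero k (keep _ e) _ _ = e
flip-zero {s} k (flip k′ e₁ _ _) uk≡0 uk′≡0 with kindView k k′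
... | same      = contradiction (trans (sym e₁) uk≡0) (unit≢0 s)
... | different = contradiction (trans (sym e₁) uk′≡0) (unit≢0 s)

flip-sign : ∀ {s s′ u} k → Flip s s′ u → u k ≢ 0ℤ → sign (u k) ≡ s
flip-sign {s} k F uk≢0 = trans (cong sign (proj₁ (flip-nonzero k F uk≢0))) (ℤₚ.sign-◃ s 1)

flip-fixed : ∀ {s u} → Flip s s u → ∀ k → u k ≡ 0ℤ
flip-fixed (keep u≡0 _) = u≡0
flip-fixed (flip _ _ _ s≡-s) = contradiction s≡-s (Signₚ.s≢opposite[s] _)

flip-sym : ∀ {s s′ u} → Flip s s′ u → Flip s′ s (λ k → - u k)
flip-sym (keep u≡0 e) = keep (λ k → cong -_ (u≡0 k)) (sym e)
flip-sym {s} (flip k e₁ e₂ refl) =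
  flip k (trans (cong -_ e₁) (-unit s)) (cong -_ e₂) (sym (Signₚ.opposite-involutive s))

-- Two flips of the same kind cancel, since the second starts from the opposite sign. Flips of
-- different kinds would restore the sign while leaving both parts nonzero; the disjointness
-- hypothesis excludes them.
flip-trans : ∀ {s s′ s″ u v} → Flip s s′ u → Flip s′ s″ v → (∀ k → u k ≢ 0ℤ → v (other k) ≡ 0ℤ) →
  Flip s s″ (λ k → u k + v k)
flip-trans (keep u≡0 refl) (keep v≡0 e) _ = keep (λ k → cong₂ _+_ (u≡0 k) (v≡0 k)) e
flip-trans (keep u≡0 refl) (flip k e₁ e₂ e₃) _ =
  flip k (trans (cong₂ _+_ (u≡0 k) e₁) (ℤₚ.+-identityˡ _)) (cong₂ _+_ (u≡0 (other k)) e₂) e₃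
flip-trans (flip k e₁ e₂ e₃) (keep v≡0 refl) _ =
  flip k (trans (cong₂ _+_ e₁ (v≡0 k)) (ℤₚ.+-identityʳ _)) (cong₂ _+_ e₂ (v≡0 (other k))) e₃
flip-trans {s} (flip k e₁ e₂ refl) (flip k′ e₁′ e₂′ refl) disjoint with kindView k k′
... | same = keep (both-kinds k
        (trans (cong₂ _+_ e₁ (trans e₁′ (sym (-unit s)))) (ℤₚ.+-inverseʳ (s ◃ 1))) (cong₂ _+_ e₂ e₂′))
        (Signₚ.opposite-involutive s)
... | different = contradiction
        (trans (sym e₁′) (disjoint k (λ uk≡0 → unit≢0 s (trans (sym e₁) uk≡0)))) (unit≢0 (opposite s))

only : ∀ {n} → Kind → Chain n → Kind → Chain n
only circuit   P circuit   = P
only circuit   P cocircuit = λ _ → 0ℤ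
only cocircuit P circuit   = λ _ → 0ℤ
only cocircuit P cocircuit = P

only-same : ∀ {n} k (P : Chain n) → only k P k ≡ P
only-same circuit   P = refl
only-same cocircuit P = refl

only-different : ∀ {n} k (P : Chain n) → only k P (other k) ≡ λ _ → 0ℤ
only-different circuit   P = refl
only-different cocircuit P = refl

module _ {r n} (A : Mat r n) where

  only-inSpace : ∀ k {P} → InSpace A k P → ∀ k′ → InSpace A k′ (only k P k′)
  only-inSpace k {P} P∈ = both-kinds k
    (subst (InSpace A k) (sym (only-same k P)) P∈)
    (subst (InSpace A (other k)) (sym (only-different k P)) (inSpace-zero A (other k)))

  Reversal : Orientation n → Orientation n → (Kind → Chain n) → Set
  Reversal O O′ u = (∀ k → InSpace A k (u k)) × (∀ x → Flip (O x) (O′ x) (λ k → u k x))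

  Reversible : Orientation n → Orientation n → Set
  Reversible O O′ = ∃ (Reversal O O′)

  reversal-∼ : ∀ {O O′ u} → Reversal O O′ u → ∀ k → u k ∼ O
  reversal-∼ (_ , F) k x = flip-sign k (F x)

  reversible-refl : ∀ {O} → Reversible O O
  reversible-refl = (λ _ _ → 0ℤ) , inSpace-zero A , λ x → keep (λ _ → refl) refl

  reversible-sym : ∀ {O O′} → Reversible O O′ → Reversible O′ O
  reversible-sym (u , u∈ , F) = (λ k → negChain (u k)) , (λ k → inSpace-neg A k (u∈ k)) , λ x → flip-sym (F x)

  -- After reversing u, the chain − u k and the next chain v (other k) both agree with the
  -- intermediate orientation, so orthogonality makes them disjoint.
  reversible-trans : ∀ {O O′ O″} → Reversible O O′ → Reversible O′ O″ → Reversible O O″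
  reversible-trans {O} {O′} (u , u∈ , F) (v , v∈ , G) =
    (λ k x → u k x + v k x) , (λ k → inSpace-+ A k (u∈ k) (v∈ k)) ,
    λ x → flip-trans (F x) (G x) λ k ukx≢0 →
      sameSign⇒disjoint A k (inSpace-neg A k (u∈ k)) (v∈ (other k))
        (λ y -uky≢0 vky≢0 → trans (flip-sign k (flip-sym (F y)) -uky≢0) (sym (flip-sign (other k) (G y) vky≢0)))
        x (neg≢0 ukx≢0)

  reversible-isEquivalence : IsEquivalence Reversible
  reversible-isEquivalence = record
    { refl = reversible-refl ; sym = reversible-sym ; trans = reversible-trans }

  reversible-rev : ∀ k {P O O′} → SignedOf A k P → P ∼ O → O′ ≗ rev (supp P) O → Reversible O O′
  reversible-rev k {P} {O} {O′} P∈ P∼O e = only k P , only-inSpace k (signed-inSpace A k P∈) , λ x → pointwise x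
    where
    at-same : ∀ x → only k P k x ≡ P x
    at-same x = cong (λ Q → Q x) (only-same k P)
    at-other : ∀ x → only k P (other k) x ≡ 0ℤ
    at-other x = cong (λ Q → Q x) (only-different k P)
    pointwise : ∀ x → Flip (O x) (O′ x) (λ k′ → only k P k′ x)
    pointwise x with P x ℤ.≟ 0ℤ
    ... | yes Px≡0 = keep (both-kinds k (trans (at-same x) Px≡0) (at-other x)) (trans (e x) (rev-nonsupp P O Px≡0))
    ... | no  Px≢0 = flip k (trans (at-same x) (simple-unit (O x) (signed-simple A k P∈ x) Px≢0 (P∼O x Px≢0)))
                       (at-other x) (trans (e x) (rev-supp P O Px≢0))

  revStep⇒reversible : ∀ {O O′} → RevStep A O O′ → Reversible O O′
  revStep⇒reversible (P , inj₁ P∈ , P∼O , e) = reversible-rev circuit P∈ P∼O e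
  revStep⇒reversible (P , inj₂ P∈ , P∼O , e) = reversible-rev cocircuit P∈ P∼O e

  ccEquiv⇒reversible : ∀ {O O′} → CCEquiv A O O′ → Reversible O O′
  ccEquiv⇒reversible {O} {O′} (O″ , chain , O″≗O′)
    with u , u∈ , F ← fold reversible-isEquivalence revStep⇒reversible chain =
    u , u∈ , λ x → subst (λ s → Flip (O x) s _) (O″≗O′ x) (F x)

  -- Where the two orientations agree, u is zero, so their common sign may be replaced by any other
  -- common sign. This lets the reversal of f be carried past an equivalence that fixes f.
  reversible-reorient : ∀ {O O′ P P′} →
    (∀ x → (P x ≡ O x × P′ x ≡ O′ x) ⊎ (O x ≡ O′ x × P x ≡ P′ x)) → Reversible O O′ → Reversible P P′
  reversible-reorient {O} {O′} {P} {P′} cases (u , u∈ , F) = u , u∈ , pointwise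
    where
    pointwise : ∀ x → Flip (P x) (P′ x) (λ k → u k x)
    pointwise x with cases x
    ... | inj₁ (e , e′) = subst₂ (λ s s′ → Flip s s′ _) (sym e) (sym e′) (F x)
    ... | inj₂ (e , e′) = keep (flip-fixed (subst (λ s → Flip (O x) s _) (sym e) (F x))) (sym e′)

-- Arcs and the canonical action

module Arc {n} {a : Chain n} {f} (arc : IsArc a f) where

  a-support : ∀ {x} → a x ≢ 0ℤ → x ≡ f
  a-support = proj₁ (proj₂ arc) _

  af≢0 : a f ≢ 0ℤ
  af≢0 = proj₂ (proj₂ arc)

  ∼-arc : ∀ {O} → O f ≡ sign (a f) → a ∼ O
  ∼-arc e x ax≢0 with refl ← a-support ax≢0 = sym e

  ∼-arc⁻¹ : ∀ {O} → a ∼ O → O f ≡ sign (a f)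
  ∼-arc⁻¹ a∼O = sym (a∼O f af≢0)

  ∼-negArc : ∀ {O} → O f ≡ opposite (sign (a f)) → negChain a ∼ O
  ∼-negArc e x -ax≢0 with refl ← a-support (-ax≢0 ∘ cong -_) = trans (sign-neg af≢0) (sym e)

  ∼-negArc⁻¹ : ∀ {O} → negChain a ∼ O → O f ≡ opposite (sign (a f))
  ∼-negArc⁻¹ -a∼O = trans (sym (-a∼O f (neg≢0 af≢0))) (sign-neg af≢0)

  rev-arc : ∀ O → rev (supp a) O f ≡ opposite (O f)
  rev-arc O = rev-supp a O af≢0

  rev-offArc : ∀ O {x} → x ≢ f → rev (supp a) O x ≡ O x
  rev-offArc O {x} x≢f = rev-nonsupp a O (decidable-stable (a x ℤ.≟ 0ℤ) (x≢f ∘ a-support))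

  rev-f : ∀ O → rev ⁅ f ⁆ O f ≡ opposite (O f)
  rev-f O = rev-∈ O (x∈⁅x⁆ f)

  rev-off-f : ∀ O {x} → x ≢ f → rev ⁅ f ⁆ O x ≡ O x
  rev-off-f O x≢f = rev-∉ O (x≢f ∘ x∈⁅y⁆⇒x≡y f)

module Canonical {r n} (A : Mat r n) (tu : TotallyUnimodular A) (frr : FullRowRank A)
  (σ σ* : Subset n → Chain n) {a : Chain n} {f : Fin n} (arc : IsArc a f)
  {O₁ O₂ : Orientation n} (compat₁ : SigCompatible A σ σ* O₁) (compat₂ : SigCompatible A σ σ* O₂)
  where

  open Arc arc

  not-both-compatible : ∀ k {C x} → SignedOf A k C → C ∼ O₁ → negChain C ∼ O₂ → C x ≢ 0ℤ → ⊥
  not-both-compatible k {C} {x} C∈ C∼O₁ -C∼O₂ Cx≢0 =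
    -- C and - C have the same support, so the signature returns the same chain for both.
    Cx≢0 (≡-neg⇒≡0 (trans (sym (in-σ₁ x)) (trans (cong (λ S → sig k S x) (sym (supp-neg C))) (in-σ₂ x))))
    where
    sig : Kind → Subset n → Chain n
    sig circuit   = σ
    sig cocircuit = σ*
    compatible : ∀ k {O C} → SigCompatible A σ σ* O → SignedOf A k C → C ∼ O → InSig (sig k) C
    compatible circuit   c C∈ C∼O = proj₁ c _ C∈ C∼O
    compatible cocircuit c C∈ C∼O = proj₂ c _ C∈ C∼O
    in-σ₁ = compatible k compat₁ C∈ C∼O₁
    in-σ₂ = compatible k compat₂ (signed-neg A k C∈) -C∼O₂

  negChain-∼ : ∀ {C : Chain n} {O O′ : Orientation n} → C ∼ O → (∀ x → C x ≢ 0ℤ → O′ x ≡ opposite (O x)) → negChain C ∼ O′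
  negChain-∼ C∼O opp x -Cx≢0 = trans (sign-neg Cx≢0) (trans (cong opposite (C∼O x Cx≢0)) (sym (opp x Cx≢0)))
    where Cx≢0 = -Cx≢0 ∘ cong -_

  LastStep : Kind → Orientation n → Set
  LastStep k O = O ≗ O₂ ⊎ ∃ λ D → SignedOf A k D × D f ≢ 0ℤ × D ∼ O × rev (supp D) O ≗ O₂

  -- The coefficient of a reversal at f is 0, 1 or -1, so `conformal-through` leaves no reversal at
  -- all or that of one piece.
  lastStep : ∀ k {O u} → Reversal A O O₂ u → u (other k) ≗ (λ _ → 0ℤ) →
    (∀ {C x} → SignedOf A k C → C ⊑ u k → C x ≢ 0ℤ → C f ≢ 0ℤ) → LastStep k O
  lastStep k {O} {u} R@(u∈ , F) u′≡0 through with conformal-through A tu frr k (u∈ k) small through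
    where
    small : ∣ u k f ∣ ℕ.≤ 1
    small with u k f ℤ.≟ 0ℤ
    ... | yes ukf≡0 = ℕₚ.≤-trans (ℕₚ.≤-reflexive (cong ∣_∣ ukf≡0)) ℕ.z≤n
    ... | no  ukf≢0 = ℕₚ.≤-reflexive (trans (cong ∣_∣ (proj₁ (flip-nonzero k (F f) ukf≢0))) (ℤₚ.abs-◃ (O f) 1))
  ... | inj₁ u≡0 = inj₁ λ x → sym (flip-zero k (F x) (u≡0 x) (u′≡0 x))
  ... | inj₂ (D , D∈ , u≡D , Df≢0) = inj₂ (D , D∈ , Df≢0 , D∼O , reversed)
    where
    D∼O : D ∼ O
    D∼O x Dx≢0 = trans (cong sign (sym (u≡D x))) (reversal-∼ A R k x (λ ux≡0 → Dx≢0 (trans (sym (u≡D x)) ux≡0)))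
    reversed : rev (supp D) O ≗ O₂
    reversed x with D x ℤ.≟ 0ℤ
    ... | yes Dx≡0 = trans (rev-nonsupp D O Dx≡0) (sym (flip-zero k (F x) (trans (u≡D x) Dx≡0) (u′≡0 x)))
    ... | no  Dx≢0 = trans (rev-supp D O Dx≢0)
      (sym (proj₂ (proj₂ (flip-nonzero k (F x) (λ ux≡0 → Dx≢0 (trans (sym (u≡D x)) ux≡0))))))

  module _ {O : Orientation n} (O₁~O : Reversible A O₁ O) (-a∼O : negChain a ∼ O)
           (O-a~O₂ : Reversible A (rev (supp a) O) O₂) where

    private
      -- As O′ and O agree at f, the chains that carry O′ to O are zero at f and still do so after f
      -- is reversed in both.
      reverse-arc : ∀ {O′} → O′ f ≡ O f → Reversible A O′ O → Reversible A (rev ⁅ f ⁆ O′) O₂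
      reverse-arc {O′} O′f≡Of R = reversible-trans A (reversible-reorient A cases R) O-a~O₂
        where
        cases : ∀ x → (rev ⁅ f ⁆ O′ x ≡ O′ x × rev (supp a) O x ≡ O x)
                    ⊎ (O′ x ≡ O x × rev ⁅ f ⁆ O′ x ≡ rev (supp a) O x)
        cases x with x ≟ f
        ... | no x≢f   = inj₁ (rev-off-f O′ x≢f , rev-offArc O x≢f)
        ... | yes refl = inj₂ (O′f≡Of , trans (rev-f O′) (trans (cong opposite O′f≡Of) (sym (rev-arc O))))

    module Direct (-a∼O₁ : negChain a ∼ O₁) where

      O″ = rev ⁅ f ⁆ O₁

      O″f : O″ f ≡ sign (a f)
      O″f = trans (rev-f O₁) (trans (cong opposite (∼-negArc⁻¹ -a∼O₁)) (Signₚ.opposite-involutive _))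

      -- A piece that avoids f does not notice the reversal of f, so it conforms to O₁. It is
      -- reversed entirely on the way to O₂, so its negative conforms to O₂.
      through : ∀ {u} → Reversal A O″ O₂ u → ∀ k {C x} → SignedOf A k C → C ⊑ u k → C x ≢ 0ℤ → C f ≢ 0ℤ
      through {u} R@(u∈ , F) k {C} C∈ C⊑u Cx≢0 Cf≡0 = not-both-compatible k C∈ C∼O₁ -C∼O₂ Cx≢0
        where
        C∼O″ : C ∼ O″
        C∼O″ = ∼-⊑ C⊑u (reversal-∼ A R k)
        C∼O₁ : C ∼ O₁
        C∼O₁ x Cx≢0 = trans (C∼O″ x Cx≢0) (rev-off-f O₁ (λ { refl → Cx≢0 Cf≡0 }))
        -C∼O₂ : negChain C ∼ O₂
        -C∼O₂ = negChain-∼ C∼O″ (λ x Cx≢0 → proj₂ (proj₂ (flip-nonzero k (F x) (proj₁ (C⊑u x Cx≢0)))))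

      outcome : ∃ λ k → LastStep k O″
      outcome with u , R@(u∈ , F) ← reverse-arc (trans (∼-negArc⁻¹ -a∼O₁) (sym (∼-negArc⁻¹ -a∼O))) O₁~O = choose (F f)
        where
        vanish : ∀ k → u k f ≡ 0ℤ → u k ≗ (λ _ → 0ℤ)
        vanish k ukf≡0 x = decidable-stable (u k x ℤ.≟ 0ℤ) λ ukx≢0 →
          let C , C∈ , C⊑u , Cx≢0 = conformal-signed A tu frr k (u∈ k) ukx≢0
          in proj₁ (C⊑u f (through R k C∈ C⊑u Cx≢0)) ukf≡0
        choose : Flip (O″ f) (O₂ f) (λ k → u k f) → ∃ λ k → LastStep k O″
        -- Neither part meets f, so both vanish, and the kind `circuit` is an arbitrary choice.
        choose (keep uf≡0 _)      = circuit , lastStep circuit R (vanish cocircuit (uf≡0 cocircuit)) (through R circuit)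
        choose (flip k _ u′f≡0 _) = k , lastStep k R (vanish (other k) u′f≡0) (through R k)

      toProcess : ∃ (λ k → LastStep k O″) → Process A a f O₁ O₂
      toProcess (k , inj₁ O″≗O₂) = record
        { step₁ = nothing ; valid₁ = tt ; step₃ = nothing ; valid₃ = tt ; result = O″≗O₂
        ; partA = (λ ()) , λ a∼O₁ → Signₚ.s≢opposite[s] _ (trans (sym (∼-arc⁻¹ a∼O₁)) (∼-negArc⁻¹ -a∼O₁))
        ; partB = (λ ()) , λ -a∼O₂ → Signₚ.s≢opposite[s] _ (trans (sym O″f) (trans (O″≗O₂ f) (∼-negArc⁻¹ -a∼O₂)))
        ; partC = λ _ _ _ _ () ; partD = λ _ _ _ _ () }
      toProcess (k , inj₂ (D , D∈ , Df≢0 , D∼O″ , reversed)) = record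
        { step₁ = nothing ; valid₁ = tt ; step₃ = just (k , D) ; valid₃ = D∈ , ∈-supp⁺ D Df≢0 , D∼O″
        ; result = reversed
        ; partA = (λ ()) , λ a∼O₁ → Signₚ.s≢opposite[s] _ (trans (sym (∼-arc⁻¹ a∼O₁)) (∼-negArc⁻¹ -a∼O₁))
        ; partB = (λ _ → ∼-negArc (trans (sym (reversed f)) (trans (rev-supp D O″ Df≢0) (cong opposite O″f))))
                , λ _ → tt
        ; partC = λ _ _ _ _ () ; partD = λ _ _ _ _ () }

      process : Process A a f O₁ O₂
      process = toProcess outcome

    module Indirect (a∼O₁ : a ∼ O₁) where

      Of≡-O₁f : O f ≡ opposite (O₁ f)
      Of≡-O₁f = trans (∼-negArc⁻¹ -a∼O) (cong opposite (sym (∼-arc⁻¹ a∼O₁)))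

      reoriented : (C : Chain n) → Orientation n
      reoriented C = rev ⁅ f ⁆ (rev (supp C) O₁)

      module _ (C : Chain n) (Cf≢0 : C f ≢ 0ℤ) where

        reoriented-f : reoriented C f ≡ O₁ f
        reoriented-f = trans (rev-f (rev (supp C) O₁)) (trans (cong opposite (rev-supp C O₁ Cf≢0)) (Signₚ.opposite-involutive _))

        reoriented-inside : ∀ {x} → x ≢ f → C x ≢ 0ℤ → reoriented C x ≡ opposite (O₁ x)
        reoriented-inside x≢f Cx≢0 = trans (rev-off-f (rev (supp C) O₁) x≢f) (rev-supp C O₁ Cx≢0)

        reoriented-outside : ∀ {x} → C x ≡ 0ℤ → reoriented C x ≡ O₁ x
        reoriented-outside Cx≡0 = trans (rev-off-f (rev (supp C) O₁) (λ { refl → Cf≢0 Cx≡0 })) (rev-nonsupp C O₁ Cx≡0)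

      -- O and O₁ differ at f, so exactly one part of their difference is nonzero at f. Any of its
      -- conforming pieces through f serves as a provisional first step.
      firstReversal : Reversible A O₁ O → ∃ λ k → ∃ λ P → SignedOf A k P × P ∼ O₁ × P f ≢ 0ℤ
      firstReversal (u , R@(u∈ , F)) with F f
      ... | keep _ Of≡O₁f = contradiction (trans (sym Of≡O₁f) Of≡-O₁f) (Signₚ.s≢opposite[s] _)
      ... | flip k ukf _ _ with P , P∈ , P⊑u , Pf≢0 ←
              conformal-signed A tu frr k {u k} {f} (u∈ k) (λ ukf≡0 → unit≢0 (O₁ f) (trans (sym ukf) ukf≡0)) =
        k , P , P∈ , ∼-⊑ P⊑u (reversal-∼ A R k) , Pf≢0

      after-reversal : ∀ k {P} → SignedOf A k P → P ∼ O₁ → P f ≢ 0ℤ → Reversible A (reoriented P) O₂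
      after-reversal k {P} P∈ P∼O₁ Pf≢0 = reverse-arc (trans (rev-supp P O₁ Pf≢0) (sym Of≡-O₁f))
        (reversible-trans A (reversible-sym A (reversible-rev A k P∈ P∼O₁ (λ _ → refl))) O₁~O)

      -- Reversing P, then f, then the part u k of kind k amounts to reversing f and P + u k, which is
      -- itself a single signed (co)circuit through f; taking it as the first step leaves only the
      -- other kind for the last step.
      module _ (k : Kind) {P} (P∈ : SignedOf A k P) (P∼O₁ : P ∼ O₁) (Pf≢0 : P f ≢ 0ℤ)
               {u} (R : Reversal A (reoriented P) O₂ u) where

        private
          u∈ = proj₁ R
          F = proj₂ R

          N v : Chain n
          N x = P x + u k x
          v = u (other k)

          N∈ : InSpace A k N
          N∈ = inSpace-+ A k (signed-inSpace A k P∈) (u∈ k)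

          P-unit : ∀ {x} → P x ≢ 0ℤ → P x ≡ O₁ x ◃ 1
          P-unit {x} Px≢0 = simple-unit (O₁ x) (signed-simple A k P∈ x) Px≢0 (P∼O₁ x Px≢0)

          -- The last four cases tell how `u k` changes P off f. In `leaves` the element is reversed
          -- by P and then back by `u k`, so the two coefficients cancel.
          data View (x : Fin n) : Set where
            at-f      : x ≡ f → View x
            untouched : x ≢ f → P x ≡ 0ℤ → u k x ≡ 0ℤ → N x ≡ 0ℤ → View x
            enters    : x ≢ f → P x ≡ 0ℤ → N x ≡ O₁ x ◃ 1 → u k x ≢ 0ℤ → v x ≡ 0ℤ →
                        O₂ x ≡ opposite (O₁ x) → View x
            stays     : x ≢ f → P x ≢ 0ℤ → u k x ≡ 0ℤ → N x ≡ O₁ x ◃ 1 → View x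
            leaves    : x ≢ f → P x ≢ 0ℤ → u k x ≢ 0ℤ → N x ≡ 0ℤ → View x

          view : ∀ x → View x
          view x with x ≟ f | P x ℤ.≟ 0ℤ | u k x ℤ.≟ 0ℤ
          ... | yes x≡f | _ | _ = at-f x≡f
          ... | no x≢f | yes Px≡0 | yes ux≡0 = untouched x≢f Px≡0 ux≡0 (cong₂ _+_ Px≡0 ux≡0)
          ... | no x≢f | no  Px≢0 | yes ux≡0 =
            stays x≢f Px≢0 ux≡0 (trans (cong₂ _+_ (P-unit Px≢0) ux≡0) (ℤₚ.+-identityʳ _))
          ... | no x≢f | yes Px≡0 | no ux≢0 with e , vx≡0 , e′ ← flip-nonzero k (F x) ux≢0 =
            enters x≢f Px≡0
              (trans (cong₂ _+_ Px≡0 (trans e (cong (_◃ 1) unaltered))) (ℤₚ.+-identityˡ _))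
              ux≢0 vx≡0 (trans e′ (cong opposite unaltered))
            where unaltered = reoriented-outside P Pf≢0 Px≡0
          ... | no x≢f | no Px≢0 | no ux≢0 with e , _ ← flip-nonzero k (F x) ux≢0 =
            leaves x≢f Px≢0 ux≢0 (trans (cong₂ _+_ (P-unit Px≢0)
              (trans e (trans (cong (_◃ 1) (reoriented-inside P Pf≢0 x≢f Px≢0)) (sym (-unit (O₁ x))))))
              (ℤₚ.+-inverseʳ (O₁ x ◃ 1)))

          u-at-f : u k f ≢ 0ℤ → u k f ≡ O₁ f ◃ 1 × v f ≡ 0ℤ × O₂ f ≡ opposite (O₁ f)
          u-at-f uf≢0 with e , vf≡0 , e′ ← flip-nonzero k (F f) uf≢0 =
            trans e (cong (_◃ 1) (reoriented-f P Pf≢0)) , vf≡0 , trans e′ (cong opposite (reoriented-f P Pf≢0))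

          -- Reversing P and then f restores the sign of O₁ at f. There `u k` has the same sign as
          -- P, so the coefficients add up, possibly to absolute value two, and cannot cancel.
          N-at-f : N f ≢ 0ℤ × sign (N f) ≡ O₁ f
          N-at-f with u k f ℤ.≟ 0ℤ
          ... | yes uf≡0 = (λ Nf≡0 → Pf≢0 (trans (sym Nf≡Pf) Nf≡0)) , trans (cong sign Nf≡Pf) (P∼O₁ f Pf≢0)
            where
            Nf≡Pf : N f ≡ P f
            Nf≡Pf = trans (cong (P f +_) uf≡0) (ℤₚ.+-identityʳ (P f))
          ... | no uf≢0 = (λ Nf≡0 → contradiction (trans (sym Nf≡2) Nf≡0) (proj₁ (double (O₁ f))))
                        , trans (cong sign Nf≡2) (proj₂ (double (O₁ f)))
            where
            Nf≡2 : N f ≡ (O₁ f ◃ 1) + (O₁ f ◃ 1)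
            Nf≡2 = cong₂ _+_ (P-unit Pf≢0) (proj₁ (u-at-f uf≢0))
            double : ∀ s → (s ◃ 1) + (s ◃ 1) ≢ 0ℤ × sign ((s ◃ 1) + (s ◃ 1)) ≡ s
            double Sign.+ = (λ ()) , refl
            double Sign.- = (λ ()) , refl

          unit-sign : ∀ {x} → N x ≡ O₁ x ◃ 1 → sign (N x) ≡ O₁ x
          unit-sign {x} e = trans (cong sign e) (ℤₚ.sign-◃ (O₁ x) 1)

          N∼O₁ : N ∼ O₁
          N∼O₁ x Nx≢0 with view x
          ... | at-f refl               = proj₂ N-at-f
          ... | untouched _ _ _ Nx≡0    = contradiction Nx≡0 Nx≢0
          ... | enters _ _ e _ _ _      = unit-sign e
          ... | stays _ _ _ e           = unit-sign e
          ... | leaves _ _ _ Nx≡0       = contradiction Nx≡0 Nx≢0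

          -- Off f, an overlap of C and v lies where P has reversed and `u k` has not; v then has
          -- the sign opposite to O₁, which is that of - C. Orthogonality therefore rules out any
          -- overlap, and all of C is reversed between O₁ and O₂, against compatibility. At f this
          -- works only if `u k` is nonzero there, whence the last hypothesis.
          no-conformal : ∀ {C x} → SignedOf A k C → C ⊑ N → C x ≢ 0ℤ → (C f ≢ 0ℤ → u k f ≢ 0ℤ) → ⊥
          no-conformal {C} {x} C∈ C⊑N Cx≢0 uf≢0 = not-both-compatible k C∈ C∼O₁ (negChain-∼ C∼O₁ opposed) Cx≢0
            where
            C∼O₁ : C ∼ O₁
            C∼O₁ = ∼-⊑ C⊑N N∼O₁
            same-sign : ∀ y → - C y ≢ 0ℤ → v y ≢ 0ℤ → sign (- C y) ≡ sign (v y)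
            same-sign y -Cy≢0 vy≢0 with view y
            same-sign y -Cy≢0 vy≢0 | at-f refl = contradiction (proj₁ (proj₂ (u-at-f (uf≢0 (-Cy≢0 ∘ cong -_))))) vy≢0
            same-sign y -Cy≢0 vy≢0 | untouched _ _ _ Ny≡0 =
              contradiction Ny≡0 (proj₁ (C⊑N y (-Cy≢0 ∘ cong -_)))
            same-sign y -Cy≢0 vy≢0 | enters _ _ _ _ vy≡0 _ = contradiction vy≡0 vy≢0
            same-sign y -Cy≢0 vy≢0 | leaves _ _ _ Ny≡0 =
              contradiction Ny≡0 (proj₁ (C⊑N y (-Cy≢0 ∘ cong -_)))
            same-sign y -Cy≢0 vy≢0 | stays y≢f Py≢0 _ _ =
              trans (sign-neg Cy≢0) (trans (cong opposite (C∼O₁ y Cy≢0))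
                (trans (sym (reoriented-inside P Pf≢0 y≢f Py≢0)) (sym (reversal-∼ A R (other k) y vy≢0))))
              where Cy≢0 = -Cy≢0 ∘ cong -_
            C⊥v : ∀ y → C y ≢ 0ℤ → v y ≡ 0ℤ
            C⊥v y Cy≢0 = sameSign⇒disjoint A k (inSpace-neg A k (signed-inSpace A k C∈)) (u∈ (other k))
              same-sign y (neg≢0 Cy≢0)
            opposed : ∀ y → C y ≢ 0ℤ → O₂ y ≡ opposite (O₁ y)
            opposed y Cy≢0 with view y
            opposed y Cy≢0 | at-f refl = proj₂ (proj₂ (u-at-f (uf≢0 Cy≢0)))
            opposed y Cy≢0 | untouched _ _ _ Ny≡0 = contradiction Ny≡0 (proj₁ (C⊑N y Cy≢0))
            opposed y Cy≢0 | leaves _ _ _ Ny≡0 = contradiction Ny≡0 (proj₁ (C⊑N y Cy≢0))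
            opposed y Cy≢0 | enters _ _ _ _ _ e = e
            opposed y Cy≢0 | stays y≢f Py≢0 uy≡0 _ =
              trans (flip-zero k (F y) uy≡0 (C⊥v y Cy≢0)) (reoriented-inside P Pf≢0 y≢f Py≢0)

          uf≡0 : u k f ≡ 0ℤ
          uf≡0 = decidable-stable (u k f ℤ.≟ 0ℤ) λ uf≢0 →
            -- If `u k f` were nonzero, the hypothesis of `no-conformal` about f would hold for
            -- every piece, so N, being nonzero at f, could have none.
            let C , C∈ , C⊑N , Cf≢0 = conformal-signed A tu frr k N∈ (proj₁ N-at-f)
            in no-conformal C∈ C⊑N Cf≢0 (λ _ → uf≢0)

          Nf-small : ∣ N f ∣ ℕ.≤ 1
          Nf-small = ℕₚ.≤-reflexive (trans
            (cong ∣_∣ (trans (cong₂ _+_ (P-unit Pf≢0) uf≡0) (ℤₚ.+-identityʳ (O₁ f ◃ 1)))) (ℤₚ.abs-◃ (O₁ f) 1))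

        merged : ∃ λ C → SignedOf A k C × C ∼ O₁ × C f ≢ 0ℤ × Reversal A (reoriented C) O₂ (only (other k) v)
        merged with conformal-through A tu frr k N∈ Nf-small (λ C∈ C⊑N Cx≢0 Cf≡0 → no-conformal C∈ C⊑N Cx≢0 (contradiction Cf≡0))
        ... | inj₁ N≡0 = contradiction (N≡0 f) (proj₁ N-at-f)
        ... | inj₂ (C , C∈ , N≡C , Cf≢0) =
          C , C∈ , C∼O₁ , Cf≢0 , only-inSpace A (other k) (u∈ (other k)) , λ x → pointwise x
          where
          C∼O₁ : C ∼ O₁
          C∼O₁ x Cx≢0 = trans (cong sign (sym (N≡C x))) (N∼O₁ x (λ Nx≡0 → Cx≢0 (trans (sym (N≡C x)) Nx≡0)))
          C-nonzero : ∀ {x} → N x ≡ O₁ x ◃ 1 → C x ≢ 0ℤ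
          C-nonzero {x} e Cx≡0 = unit≢0 (O₁ x) (trans (sym e) (trans (N≡C x) Cx≡0))
          C-zero : ∀ {x} → N x ≡ 0ℤ → C x ≡ 0ℤ
          C-zero {x} Nx≡0 = trans (sym (N≡C x)) Nx≡0
          part = only (other k) v
          part-at : ∀ {x} → v x ≡ part (other k) x
          part-at {x} = cong (λ w → w x) (sym (only-same (other k) v))
          part-off : ∀ {x} → part k x ≡ 0ℤ
          part-off {x} = trans (cong (λ j → part j x) (sym (other-involutive k)))
                               (cong (λ w → w x) (only-different (other k) v))
          unaffected : ∀ {x} → u k x ≡ 0ℤ → reoriented C x ≡ reoriented P x → Flip (reoriented C x) (O₂ x) (λ j → part j x)
          unaffected {x} ux≡0 e = subst (λ s → Flip s (O₂ x) _) (sym e) (drop (v x ℤ.≟ 0ℤ))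
            where
            drop : Dec (v x ≡ 0ℤ) → Flip (reoriented P x) (O₂ x) (λ j → part j x)
            drop (yes vx≡0) = keep (both-kinds k part-off (trans (sym part-at) vx≡0)) (flip-zero k (F x) ux≡0 vx≡0)
            drop (no  vx≢0) with e₁ , _ , e₂ ← flip-nonzero (other k) (F x) vx≢0 =
              flip (other k) (trans (sym part-at) e₁) (trans (cong (λ j → part j x) (other-involutive k)) part-off) e₂
          -- On these elements, using C in place of P already carries out the reversal by `u k`, so
          -- nothing is left for the last step.
          absorbed : ∀ {x} → u k x ≢ 0ℤ → reoriented C x ≡ opposite (reoriented P x) →
            Flip (reoriented C x) (O₂ x) (λ j → part j x)
          absorbed {x} ux≢0 e with _ , vx≡0 , e₂ ← flip-nonzero k (F x) ux≢0 =
            keep (both-kinds k part-off (trans (sym part-at) vx≡0)) (trans e₂ (sym e))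
          pointwise : ∀ x → Flip (reoriented C x) (O₂ x) (λ j → part j x)
          pointwise x with view x
          ... | at-f refl = unaffected uf≡0 (trans (reoriented-f C Cf≢0) (sym (reoriented-f P Pf≢0)))
          ... | untouched _ Px≡0 ux≡0 Nx≡0 = unaffected ux≡0
            (trans (reoriented-outside C Cf≢0 (C-zero Nx≡0)) (sym (reoriented-outside P Pf≢0 Px≡0)))
          ... | stays x≢f Px≢0 ux≡0 e = unaffected ux≡0
            (trans (reoriented-inside C Cf≢0 x≢f (C-nonzero e)) (sym (reoriented-inside P Pf≢0 x≢f Px≢0)))
          ... | enters x≢f Px≡0 e ux≢0 _ _ = absorbed ux≢0
            (trans (reoriented-inside C Cf≢0 x≢f (C-nonzero e)) (cong opposite (sym (reoriented-outside P Pf≢0 Px≡0))))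
          ... | leaves x≢f Px≢0 ux≢0 Nx≡0 = absorbed ux≢0
            (trans (reoriented-outside C Cf≢0 (C-zero Nx≡0)) (trans (sym (Signₚ.opposite-involutive (O₁ x)))
              (cong opposite (sym (reoriented-inside P Pf≢0 x≢f Px≢0)))))

      outcome : ∃ λ k → ∃ λ C → SignedOf A k C × C ∼ O₁ × C f ≢ 0ℤ × LastStep (other k) (reoriented C)
      outcome = let k , P , P∈ , P∼O₁ , Pf≢0 = firstReversal O₁~O
                    u , R = after-reversal k P∈ P∼O₁ Pf≢0
                in continue k (merged k P∈ P∼O₁ Pf≢0 R)
        where
        continue : ∀ k {v} → (∃ λ C → SignedOf A k C × C ∼ O₁ × C f ≢ 0ℤ × Reversal A (reoriented C) O₂ (only (other k) v)) →
          ∃ λ k → ∃ λ C → SignedOf A k C × C ∼ O₁ × C f ≢ 0ℤ × LastStep (other k) (reoriented C)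
        continue k {v} (C , C∈ , C∼O₁ , Cf≢0 , R@(_ , F)) = k , C , C∈ , C∼O₁ , Cf≢0 ,
          lastStep (other k) R (λ x → cong (λ w → w x) (only-different (other k) v)) through
          where
          w = only (other k) v
          -- Off f, the orientation has been reversed on C, so D has the sign of - C on any overlap.
          -- As D avoids f, orthogonality makes C and D disjoint; thus D conforms to O₁ and its
          -- negative to O₂.
          through : ∀ {D x} → SignedOf A (other k) D → D ⊑ w (other k) → D x ≢ 0ℤ → D f ≢ 0ℤ
          through {D} D∈ D⊑w Dx≢0 Df≡0 = not-both-compatible (other k) D∈ D∼O₁ -D∼O₂ Dx≢0
            where
            D∼O″ : D ∼ reoriented C
            D∼O″ = ∼-⊑ D⊑w (reversal-∼ A R (other k))
            same-sign : ∀ y → - C y ≢ 0ℤ → D y ≢ 0ℤ → sign (- C y) ≡ sign (D y)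
            same-sign y -Cy≢0 Dy≢0 = trans (sign-neg Cy≢0) (trans (cong opposite (C∼O₁ y Cy≢0))
              (trans (sym (reoriented-inside C Cf≢0 (λ { refl → Dy≢0 Df≡0 }) Cy≢0)) (sym (D∼O″ y Dy≢0))))
              where Cy≢0 = -Cy≢0 ∘ cong -_
            C-off-D : ∀ y → D y ≢ 0ℤ → C y ≡ 0ℤ
            C-off-D y Dy≢0 = decidable-stable (C y ℤ.≟ 0ℤ) λ Cy≢0 → Dy≢0
              (sameSign⇒disjoint A k (inSpace-neg A k (signed-inSpace A k C∈)) (signed-inSpace A (other k) D∈)
                same-sign y (neg≢0 Cy≢0))
            D∼O₁ : D ∼ O₁
            D∼O₁ y Dy≢0 = trans (D∼O″ y Dy≢0) (reoriented-outside C Cf≢0 (C-off-D y Dy≢0))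
            -D∼O₂ : negChain D ∼ O₂
            -D∼O₂ = negChain-∼ D∼O″ (λ y Dy≢0 → proj₂ (proj₂ (flip-nonzero (other k) (F y) (proj₁ (D⊑w y Dy≢0)))))

      module _ (k : Kind) {C D : Chain n} (C∈ : SignedOf A k C) (C∼O₁ : C ∼ O₁) (Cf≢0 : C f ≢ 0ℤ)
               (D∈ : SignedOf A (other k) D) (D∼O″ : D ∼ reoriented C) (Df≢0 : D f ≢ 0ℤ)
               (reversed : rev (supp D) (reoriented C) ≗ O₂) where

        private
          C-unit : ∀ {x} → C x ≢ 0ℤ → C x ≡ O₁ x ◃ 1
          C-unit {x} Cx≢0 = simple-unit (O₁ x) (signed-simple A k C∈ x) Cx≢0 (C∼O₁ x Cx≢0)

          D-unit : ∀ {x} → D x ≢ 0ℤ → D x ≡ reoriented C x ◃ 1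
          D-unit {x} Dx≢0 = simple-unit _ (signed-simple A (other k) D∈ x) Dx≢0 (D∼O″ x Dx≢0)

          product-f : C f * D f ≡ 1ℤ
          product-f = trans (cong₂ _*_ (C-unit Cf≢0) (trans (D-unit Df≢0) (cong (_◃ 1) (reoriented-f C Cf≢0))))
            (unit*unit (O₁ f))

          product-off-f : ∀ x → x ≢ f → C x * D x ≡ 0ℤ ⊎ C x * D x ≡ -[1+ 0 ]
          product-off-f x x≢f with C x ℤ.≟ 0ℤ | D x ℤ.≟ 0ℤ
          ... | yes Cx≡0 | _        = inj₁ (trans (cong (_* D x) Cx≡0) (ℤₚ.*-zeroˡ (D x)))
          ... | no _     | yes Dx≡0 = inj₁ (trans (cong (C x *_) Dx≡0) (ℤₚ.*-zeroʳ (C x)))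
          ... | no Cx≢0  | no Dx≢0  = inj₂ (trans
            (cong₂ _*_ (C-unit Cx≢0) (trans (D-unit Dx≢0) (cong (_◃ 1) (reoriented-inside C Cf≢0 x≢f Cx≢0))))
            (unit*-unit (O₁ x)))

          product≢0 : ∀ {x} → C x * D x ≢ 0ℤ → C x ≢ 0ℤ × D x ≢ 0ℤ
          product≢0 {x} CD≢0 = (λ Cx≡0 → CD≢0 (trans (cong (_* D x) Cx≡0) (ℤₚ.*-zeroˡ (D x))))
                             , (λ Dx≡0 → CD≢0 (trans (cong (C x *_) Dx≡0) (ℤₚ.*-zeroʳ (C x))))

          nonzero-product : ∀ {x} → C x ≢ 0ℤ → D x ≢ 0ℤ → C x * D x ≢ 0ℤ
          nonzero-product {x} Cx≢0 Dx≢0 CD≡0 with ℤₚ.i*j≡0⇒i≡0∨j≡0 (C x) CD≡0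
          ... | inj₁ Cx≡0 = Cx≢0 Cx≡0
          ... | inj₂ Dx≡0 = Dx≢0 Dx≡0

        -- On the overlap, the product of C and D is 1 at f, where the sign of O₁ has been restored,
        -- and -1 elsewhere, where it is reversed. Orthogonality thus leaves exactly one element
        -- besides f.
        intersection : ∃ λ g → g ≢ f
          × (∀ x → x ∈ (supp C ∩ supp D) → x ≡ f ⊎ x ≡ g)
          × f ∈ (supp C ∩ supp D) × g ∈ (supp C ∩ supp D)
          × O₂ ≗ rev ((supp C ∪ supp D) ─ ⁅ g ⁆) O₁
        intersection
          with g , g≢f , CDg≢0 , unique ← cancelling-term (λ x → C x * D x) f product-f product-off-f
                 (orthogonal A k (signed-inSpace A k C∈) (signed-inSpace A (other k) D∈))
          with Cg≢0 , Dg≢0 ← product≢0 {g} CDg≢0 =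
          g , g≢f , only-two , in-both Cf≢0 Df≢0 , in-both Cg≢0 Dg≢0 , λ x → trans (sym (reversed x)) (pointwise x)
          where
          in-both : ∀ {x} → C x ≢ 0ℤ → D x ≢ 0ℤ → x ∈ (supp C ∩ supp D)
          in-both Cx≢0 Dx≢0 = x∈p∩q⁺ (∈-supp⁺ C Cx≢0 , ∈-supp⁺ D Dx≢0)
          only-two : ∀ x → x ∈ (supp C ∩ supp D) → x ≡ f ⊎ x ≡ g
          only-two x x∈ with x∈C , x∈D ← x∈p∩q⁻ (supp C) (supp D) x∈ =
            unique x (nonzero-product (∈-supp⁻ C x∈C) (∈-supp⁻ D x∈D))
          O″ = reoriented C
          S = (supp C ∪ supp D) ─ ⁅ g ⁆
          flipped : ∀ {x} → x ≢ g → C x ≢ 0ℤ ⊎ D x ≢ 0ℤ → rev S O₁ x ≡ opposite (O₁ x)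
          flipped {x} x≢g nz = rev-∈ O₁ (x∈p∧x∉q⇒x∈p─q (x∈p∪q⁺ (support nz)) (x≢g ∘ x∈⁅y⁆⇒x≡y g))
            where
            support : C x ≢ 0ℤ ⊎ D x ≢ 0ℤ → x ∈ supp C ⊎ x ∈ supp D
            support (inj₁ Cx≢0) = inj₁ (∈-supp⁺ C Cx≢0)
            support (inj₂ Dx≢0) = inj₂ (∈-supp⁺ D Dx≢0)
          fixed : ∀ {x} → C x ≡ 0ℤ → D x ≡ 0ℤ → rev S O₁ x ≡ O₁ x
          fixed {x} Cx≡0 Dx≡0 = rev-∉ O₁ not-in
            where
            not-in : x ∉ S
            not-in x∈S with x∈p∪q⁻ (supp C) (supp D) (p─q⊆p (supp C ∪ supp D) ⁅ g ⁆ x∈S)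
            ... | inj₁ x∈C = ∈-supp⁻ C x∈C Cx≡0
            ... | inj₂ x∈D = ∈-supp⁻ D x∈D Dx≡0
          fixed-g : rev S O₁ g ≡ O₁ g
          fixed-g = rev-∉ O₁ (λ g∈S → x∈p─q⇒x∉q (supp C ∪ supp D) ⁅ g ⁆ g∈S (x∈⁅x⁆ g))
          elsewhere : ∀ {x} → x ≢ f → x ≢ g → Dec (C x ≡ 0ℤ) → Dec (D x ≡ 0ℤ) → rev (supp D) O″ x ≡ rev S O₁ x
          elsewhere x≢f x≢g (yes Cx≡0) (yes Dx≡0) =
            trans (rev-nonsupp D O″ Dx≡0) (trans (reoriented-outside C Cf≢0 Cx≡0) (sym (fixed Cx≡0 Dx≡0)))
          elsewhere x≢f x≢g (yes Cx≡0) (no Dx≢0) =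
            trans (rev-supp D O″ Dx≢0) (trans (cong opposite (reoriented-outside C Cf≢0 Cx≡0)) (sym (flipped x≢g (inj₂ Dx≢0))))
          elsewhere x≢f x≢g (no Cx≢0) (yes Dx≡0) =
            trans (rev-nonsupp D O″ Dx≡0) (trans (reoriented-inside C Cf≢0 x≢f Cx≢0) (sym (flipped x≢g (inj₁ Cx≢0))))
          elsewhere {x} x≢f x≢g (no Cx≢0) (no Dx≢0) with only-two x (in-both Cx≢0 Dx≢0)
          ... | inj₁ x≡f = contradiction x≡f x≢f
          ... | inj₂ x≡g = contradiction x≡g x≢g
          pointwise : ∀ x → rev (supp D) O″ x ≡ rev S O₁ x
          pointwise x with x ≟ f | x ≟ g
          -- f is reversed three times, by C, on its own and by D; in the next case g is reversed
          -- twice and returns to its sign in O₁.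
          ... | yes refl | _ = trans (rev-supp D O″ Df≢0)
            (trans (cong opposite (reoriented-f C Cf≢0)) (sym (flipped (g≢f ∘ sym) (inj₁ Cf≢0))))
          ... | no _ | yes refl = trans (rev-supp D O″ Dg≢0) (trans (cong opposite (reoriented-inside C Cf≢0 g≢f Cg≢0))
            (trans (Signₚ.opposite-involutive (O₁ x)) (sym fixed-g)))
          ... | no x≢f | no x≢g = elsewhere x≢f x≢g (C x ℤ.≟ 0ℤ) (D x ℤ.≟ 0ℤ)

      toProcess : (∃ λ k → ∃ λ C → SignedOf A k C × C ∼ O₁ × C f ≢ 0ℤ × LastStep (other k) (reoriented C)) →
                  Process A a f O₁ O₂
      toProcess (k , C , C∈ , C∼O₁ , Cf≢0 , inj₁ O″≗O₂) = record
        { step₁ = just (k , C) ; valid₁ = C∈ , ∈-supp⁺ C Cf≢0 , C∼O₁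
        ; step₃ = nothing ; valid₃ = tt ; result = O″≗O₂
        ; partA = (λ _ → a∼O₁) , λ _ → tt
        ; partB = (λ ()) , λ -a∼O₂ → Signₚ.s≢opposite[s] _ (trans (sym (∼-arc⁻¹ a∼O₁))
            (trans (sym (reoriented-f C Cf≢0)) (trans (O″≗O₂ f) (∼-negArc⁻¹ -a∼O₂))))
        ; partC = λ _ _ _ _ _ () ; partD = λ _ _ _ _ _ () }
      toProcess (k , C , C∈ , C∼O₁ , Cf≢0 , inj₂ (D , D∈ , Df≢0 , D∼O″ , reversed)) = record
        { step₁ = just (k , C) ; valid₁ = C∈ , ∈-supp⁺ C Cf≢0 , C∼O₁
        ; step₃ = just (other k , D) ; valid₃ = D∈ , ∈-supp⁺ D Df≢0 , D∼O″
        ; result = reversed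
        ; partA = (λ _ → a∼O₁) , λ _ → tt
        ; partB = (λ _ → ∼-negArc (trans (sym (reversed f)) (trans (rev-supp D (reoriented C) Df≢0)
            (cong opposite (trans (reoriented-f C Cf≢0) (∼-arc⁻¹ a∼O₁)))))) , λ _ → tt
        ; partC = λ { _ _ _ _ refl refl → other≢ }
        ; partD = λ { _ _ _ _ refl refl → intersection k C∈ C∼O₁ Cf≢0 D∈ D∼O″ Df≢0 reversed } }

      process : Process A a f O₁ O₂
      process = toProcess outcome

theorem3p6 : ∀ {r n : ℕ} (A : Mat r n) → TotallyUnimodular A → FullRowRank A →
    (σ σ* : Subset n → Chain n) → IsCircuitSignature A σ → IsCocircuitSignature A σ* →
    Triangulating A σ σ* →
    (a : Chain n) (f : Fin n) → IsArc a f →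
    (O₁ O₂ : Orientation n) → SigCompatible A σ σ* O₁ → SigCompatible A σ σ* O₂ →
    ArcActionCompat A σ σ* a O₁ O₂ →
    Process A a f O₁ O₂
theorem3p6 A tu frr σ σ* _ _ _ a f arc O₁ O₂ compat₁ compat₂ (_ , O , O₁≈O , -a∼O , O-a≈O₂) =
  by-orientation (O₁ f Signₚ.≟ sign (a f))
  where
  open Canonical A tu frr σ σ* arc compat₁ compat₂
  open Arc arc
  O₁~O = ccEquiv⇒reversible A O₁≈O
  O-a~O₂ = ccEquiv⇒reversible A O-a≈O₂
  opposite-≢ : ∀ {s t} → s ≢ t → s ≡ opposite t
  opposite-≢ {Sign.+} {Sign.+} s≢t = contradiction refl s≢t
  opposite-≢ {Sign.+} {Sign.-} _   = refl
  opposite-≢ {Sign.-} {Sign.+} _   = refl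
  opposite-≢ {Sign.-} {Sign.-} s≢t = contradiction refl s≢t
  by-orientation : Dec (O₁ f ≡ sign (a f)) → Process A a f O₁ O₂
  by-orientation (yes e) = Indirect.process O₁~O -a∼O O-a~O₂ (∼-arc e)
  by-orientation (no ¬e) = Direct.process O₁~O -a∼O O-a~O₂ (∼-negArc (opposite-≢ ¬e))
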